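{- Let $p>3$ be a prime and let $a,b$ be rationals with denominators not divisible by $p$ such that $p\nmid ab$. Then $$\sum_{k=0}^{[p/3]}\binom{3k}k\frac{b^{2k}}{a^k}\equiv\begin{cases}(-3a)^{[p/3]+1}\,U_{\frac{p-(\frac p3)}3-1}(9b,3a)\pmod p&\text{if }\big(\frac{81b^2-12a}p\big)=1,\\ -(-3a)^{[p/3]}\,U_{\frac{p-(\frac p3)}3+1}(9b,3a)\pmod p&\text{if }\big(\frac{81b^2-12a}p\big)=-1.\end{cases}$$
   Context: $[x]$ is the greatest integer not exceeding $x$. The Lucas sequence $U_n(P,Q)$ is defined by $U_0=0$, $U_1=1$, $U_{n+1}=PU_n-QU_{n-1}$ for $n\ge1$. $\big(\frac p3\big)$ is the Legendre symbol ($=1$ if $p\equiv1\pmod3$, $-1$ if $p\equiv2\pmod 3$); for a rational $r$ with denominator prime to $p$, $\big(\frac rp\big)$ is the Legendre symbol of its residue mod $p$. Congruences are in the ring of rationals with denominator prime to $p$. -}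

module Defs where

open import Data.Nat as ℕ using (ℕ; zero; suc; _∸_; _≡ᵇ_)
open import Data.Nat.DivMod using (_%_)
open import Data.Nat.Divisibility using (_∣_)
open import Data.Integer as ℤ using (ℤ; +_)
open import Data.Rational as ℚ using (ℚ; ↧ₙ_; 0ℚ; 1ℚ)
open import Data.Product using (Σ; ∃; _×_)
open import Data.Bool using (if_then_else_)
open import Relation.Nullary using (¬_)
open import Relation.Binary.PropositionalEquality using (_≡_)

_^ℚ_ : ℚ → ℕ → ℚ
x ^ℚ zero  = 1ℚ
x ^ℚ suc n = x ℚ.* (x ^ℚ n)

sumTo : ℕ → (ℕ → ℚ) → ℚ
sumTo zero    f = f 0
sumTo (suc n) f = sumTo n f ℚ.+ f (suc n)

ℤ→ℚ : ℤ → ℚ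
ℤ→ℚ z = z ℚ./ 1

ℕ→ℚ : ℕ → ℚ
ℕ→ℚ n = ℤ→ℚ (+ n)

PIntegral : ℕ → ℚ → Set
PIntegral p x = ¬ (p ∣ ↧ₙ x)

infix 4 _≈_[mod_]
_≈_[mod_] : ℚ → ℚ → ℕ → Set
x ≈ y [mod p ] = PIntegral p x × PIntegral p y ×
  Σ ℚ (λ r → PIntegral p r × (x ℚ.- y ≡ ℕ→ℚ p ℚ.* r))

LegendreOne : ℕ → ℚ → Set
LegendreOne p r = PIntegral p r × ¬ (r ≈ 0ℚ [mod p ]) ×
  Σ ℤ (λ x → ℤ→ℚ x ℚ.* ℤ→ℚ x ≈ r [mod p ])

LegendreMinusOne : ℕ → ℚ → Set
LegendreMinusOne p r = PIntegral p r × ¬ (r ≈ 0ℚ [mod p ]) ×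
  ((x : ℤ) → ¬ (ℤ→ℚ x ℚ.* ℤ→ℚ x ≈ r [mod p ]))

-- Legendre symbol (p/3) for p not divisible by 3
legendre3 : ℕ → ℤ
legendre3 p = if (p % 3) ≡ᵇ 1 then + 1 else ℤ.- (+ 1)

idx : ℕ → ℕ
idx p = ℤ.∣ + p ℤ.- legendre3 p ∣ ℕ./ 3

U : ℕ → ℚ → ℚ → ℚ
U zero          P Q = 0ℚ
U (suc zero)    P Q = 1ℚ
U (suc (suc n)) P Q = P ℚ.* U (suc n) P Q ℚ.- Q ℚ.* U n P Q

{-# OPTIONS --safe #-}

-- Write n = [p/3], P = 9b, Q = 3a.  Comparing consecutive ratios shows
-- C(3k,k) ≡ C(n+k,2k) (-27)^k (mod p) for k ≤ n, because 9n² + 9n + 2 = (3n+1)(3n+2) ≡ 0.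
-- Hence the sum is Σ C(n+k,2k) (-P²/Q)^k, which is (-Q)^(-n) U_{2n+1}(P,Q).
-- It remains to reflect the index 2n+1.  Let α be the class of X in 𝔽_p[X]/(X² - PX + Q), let β = P - α
-- and D = P² - 4Q = 81b² - 12a.  Frobenius and Euler's criterion give α^p = α or α^p = β
-- according as (D/p) = 1 or -1, that is α^(p-1) = 1 or α^(p+1) = Q.  Comparing coefficients in
-- Q^i α^j = β^i α^(i+j) with i + j = p - 1 or p + 1 relates U_i to U_j.

module Submission where

open import Defs
open import Algebra.Bundles using (CommutativeRing; CommutativeSemiring)
import Algebra.Properties.CommutativeSemiring.Binomial as Binomial
import Algebra.Properties.CommutativeSemiring.Exp as CommutativeExp
import Algebra.Properties.Semiring.Exp as Exp
import Algebra.Properties.Semiring.Mult as Mult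
import Algebra.Properties.Semiring.Sum as Sum
open import Data.Fin.Base as Fin using (Fin; fromℕ; inject₁)
open import Data.Fin.Properties using (toℕ<n; toℕ-fromℕ; toℕ-inject₁)
open import Data.Integer as ℤ using (ℤ; +_)
import Data.Integer.DivMod as ℤ
import Data.Integer.Divisibility.Signed as ℤ
import Data.Integer.Properties as ℤ
import Data.Integer.Tactic.RingSolver as ℤSolver
open import Data.Nat as ℕ using (ℕ; zero; suc; _<_; _≤_; _∸_; _+_; z≤n; s≤s; z<s; s<s)
open import Data.Nat.Combinatorics using (_C_; nCk≡nC[n∸k]; nCn≡1; nC1≡n; k>n⇒nCk≡0; nCk+nC[k+1]≡[n+1]C[k+1])
import Data.Nat.Coprimality as Coprimality
import Data.Nat.DivMod as ℕ
open import Data.Nat.Divisibility using (_∣_; divides; >⇒∤)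
open import Data.Nat.Primality using (Prime; euclidsLemma; prime⇒irreducible; prime⇒nonTrivial; prime⇒nonZero; ¬prime[1])
import Data.Nat.Properties as ℕ
import Data.Nat.Tactic.RingSolver as ℕSolver
open import Data.Product using (_×_; _,_; proj₁; proj₂; ∃)
open import Data.Rational as ℚ using (ℚ; mkℚ; ↥_; ↧_; 0ℚ; 1ℚ; toℚᵘ)
import Data.Rational.Properties as ℚ
open import Data.Rational.Solver using (module +-*-Solver)
open import Data.Rational.Unnormalised as ℚᵘ using (mkℚᵘ; *≡*)
import Data.Rational.Unnormalised.Properties as ℚᵘ
open import Data.Sum using (_⊎_; inj₁; inj₂)
open import Level using (0ℓ)
import Relation.Binary.Reasoning.Setoid as SetoidReasoning
open import Relation.Binary.PropositionalEquality using (_≡_; _≢_; refl; sym; trans; cong; cong₂; subst; module ≡-Reasoning)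
open import Relation.Nullary using (¬_; contradiction)

-- The factor -27 comes from (3k + 1)(3k + 2) + 9(n - k)(n + k + 1) = (3n + 1)(3n + 2). The ratio of
-- consecutive C(3k,k) is 3(3k + 1)(3k + 2) over (2k + 1)(2k + 2), that of consecutive C(n+k,2k) is
-- (n - k)(n + k + 1) over the same denominator, which is prime to p for k < n. Since P²/Q = 27b²/a,
-- the powers of -27 merge with b²/a. The sign (p/3) makes the reflected index uniform: `idx p` is n
-- or n + 1, and in both classes of p the sum of 2n + 1 and idx p - 1 is p - 1, that of 2n + 1 and
-- idx p + 1 is p + 1. The quadratic ring is not a field when D is a square modulo p, so α itself is
-- never cancelled: multiplying by β replaces it by the scalar Q, which is prime to p. The square
-- root of D that Frobenius requires is found inside the ring, as 2α - P. All of this is done with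
-- integers representing residues. Rationals with denominator prime to p are matched with such
-- integers only at the end.

-- Binomial coefficients modulo a prime and the Frobenius identity

suc-k*nCk : ∀ n k → suc k ℕ.* (suc n C suc k) ≡ suc n ℕ.* (n C k)
suc-k*nCk n zero = trans (cong (1 ℕ.*_) (nC1≡n (suc n))) (ℕ.*-comm 1 (suc n))
suc-k*nCk zero (suc k) = begin
  suc (suc k) ℕ.* (1 C suc (suc k)) ≡⟨ cong (suc (suc k) ℕ.*_) (k>n⇒nCk≡0 {1} {suc (suc k)} (s<s z<s)) ⟩
  suc (suc k) ℕ.* 0                 ≡⟨ ℕ.*-zeroʳ (suc (suc k)) ⟩
  0                                 ≡⟨ cong (1 ℕ.*_) (k>n⇒nCk≡0 {0} {suc k} z<s) ⟨
  1 ℕ.* (0 C suc k)                 ∎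
  where open ≡-Reasoning
suc-k*nCk (suc n) (suc k) = begin
  suc (suc k) ℕ.* (suc (suc n) C suc (suc k))
    ≡⟨ cong (suc (suc k) ℕ.*_) (nCk+nC[k+1]≡[n+1]C[k+1] (suc n) (suc k)) ⟨
  suc (suc k) ℕ.* (c + suc n C suc (suc k))
    ≡⟨ ℕ.*-distribˡ-+ (suc (suc k)) c _ ⟩
  (c + suc k ℕ.* c) + suc (suc k) ℕ.* (suc n C suc (suc k))
    ≡⟨ cong₂ (λ u v → (c + u) + v) (suc-k*nCk n k) (suc-k*nCk n (suc k)) ⟩
  (c + suc n ℕ.* (n C k)) + suc n ℕ.* (n C suc k)
    ≡⟨ ℕ.+-assoc c _ _ ⟩
  c + (suc n ℕ.* (n C k) + suc n ℕ.* (n C suc k))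
    ≡⟨ cong (c ℕ.+_) (ℕ.*-distribˡ-+ (suc n) (n C k) (n C suc k)) ⟨
  c + suc n ℕ.* (n C k + n C suc k)
    ≡⟨ cong (λ u → c + suc n ℕ.* u) (nCk+nC[k+1]≡[n+1]C[k+1] n k) ⟩
  suc (suc n) ℕ.* c ∎
  where
  open ≡-Reasoning
  c = suc n C suc k

-- By absorption p divides (k + 1) C(p,k+1) = p C(p-1,k), and it cannot divide k + 1 < p.
prime∣nCk : ∀ {p} → Prime p → ∀ {k} → suc k < p → p ∣ p C suc k
prime∣nCk {suc n} pr {k} k<p with euclidsLemma (suc k) (suc n C suc k) pr
  (divides (n C k) (trans (suc-k*nCk n k) (ℕ.*-comm (suc n) (n C k))))
... | inj₁ p∣k = contradiction p∣k (>⇒∤ k<p)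
... | inj₂ p∣C = p∣C

-- Kept general because it serves two rings: in ℤ/p it gives Fermat's little theorem, in the
-- quadratic extension it computes α^p.
module Frobenius {a ℓ} (S : CommutativeSemiring a ℓ) where
  open CommutativeSemiring S hiding (zero; sym)
    renaming (Carrier to A; _+_ to _⊕_; _*_ to _⊗_; refl to ≈-refl; trans to ≈-trans)
  open Exp semiring using (_^_)
  open Mult semiring using (×-assoc-*; ×-congʳ; ×-homo-1; ×-assocˡ) renaming (_×_ to _·_)
  open Sum semiring using (sum; sum-cong-≋; sum-init-last; sum-replicate-zero)
  open Binomial S using (binomialTerm; theorem)
  open SetoidReasoning setoid

  module _ {p} (pr : Prime p) (char : p · 1# ≈ 0#) where

    p∣m⇒m·x≈0 : ∀ {m} x → p ∣ m → m · x ≈ 0#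
    p∣m⇒m·x≈0 {m} x (divides q refl) = begin
      (q ℕ.* p) · x      ≈⟨ ×-assocˡ x q p ⟨
      q · (p · x)        ≈⟨ ×-congʳ q (×-congʳ p (*-identityˡ x)) ⟨
      q · (p · (1# ⊗ x)) ≈⟨ ×-congʳ q (×-assoc-* p 1# x) ⟨
      q · (p · 1# ⊗ x)   ≈⟨ ×-congʳ q (≈-trans (*-congʳ char) (zeroˡ x)) ⟩
      q · 0#             ≈⟨ q·0≈0 q ⟩
      0#                 ∎
      where
      q·0≈0 : ∀ q → q · 0# ≈ 0#
      q·0≈0 zero    = ≈-refl
      q·0≈0 (suc q) = ≈-trans (+-identityˡ _) (q·0≈0 q)

    frobenius : ∀ x y → (x ⊕ y) ^ p ≈ x ^ p ⊕ y ^ p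
    frobenius x y = go p refl
      where
      -- The exponent has to be a visible successor before both end terms of the binomial sum can be
      -- split off; what remains is divisible by p.
      go : ∀ k → k ≡ p → (x ⊕ y) ^ k ≈ x ^ k ⊕ y ^ k
      go zero    refl = contradiction pr λ ()
      go (suc k) refl = begin
        (x ⊕ y) ^ suc k                                ≈⟨ theorem (suc k) x y ⟩
        t Fin.zero ⊕ sum (λ i → t (Fin.suc i))                 ≈⟨ +-cong first (sum-init-last (λ i → t (Fin.suc i))) ⟩
        y ^ suc k ⊕ (sum middle ⊕ t (Fin.suc (fromℕ k)))
          ≈⟨ +-congˡ (+-cong (≈-trans (sum-cong-≋ middle≈0) (sum-replicate-zero k)) last) ⟩
        y ^ suc k ⊕ (0# ⊕ x ^ suc k)                   ≈⟨ +-congˡ (+-identityˡ _) ⟩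
        y ^ suc k ⊕ x ^ suc k                          ≈⟨ +-comm _ _ ⟩
        x ^ suc k ⊕ y ^ suc k                          ∎
        where
        t : Fin (suc (suc k)) → A
        t = binomialTerm x y (suc k)

        middle : Fin k → A
        middle i = t (Fin.suc (inject₁ i))

        middle≈0 : ∀ i → middle i ≈ 0#
        middle≈0 i = p∣m⇒m·x≈0 _ (prime∣nCk pr (s<s (subst (_< k) (sym (toℕ-inject₁ i)) (toℕ<n i))))

        first : t Fin.zero ≈ y ^ suc k
        first = ≈-trans (×-homo-1 _) (*-identityˡ _)

        last : t (Fin.suc (fromℕ k)) ≈ x ^ suc k
        last rewrite toℕ-fromℕ k | nCn≡1 (suc k) | ℕ.n∸n≡0 k = ≈-trans (×-homo-1 _) (*-identityʳ _)

-- The ring of integers modulo p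

module Congruence (p : ℕ) where

  infix 4 _≋_ _≋̸0

  -- A record instead of the bare divisibility, so that `x` and `y` can be inferred from the type of
  -- a congruence.
  record _≋_ (x y : ℤ) : Set where
    constructor mk≋
    field ∣-difference : + p ℤ.∣ x ℤ.- y

  open _≋_ public

  _≋̸0 : ℤ → Set
  x ≋̸0 = ¬ (x ≋ + 0)

  ≋-reflexive : ∀ {x y} → x ≡ y → x ≋ y
  ≋-reflexive {x} refl = mk≋ (ℤ.divides (+ 0) (ℤ.+-inverseʳ x))

  ≋-sym : ∀ {x y} → x ≋ y → y ≋ x
  ≋-sym {x} {y} (mk≋ d) = mk≋ (subst (+ p ℤ.∣_) (lemma x y) (ℤ.∣m⇒∣-m d))
    where
    lemma : ∀ x y → ℤ.- (x ℤ.- y) ≡ y ℤ.- x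
    lemma = ℤSolver.solve-∀

  ≋-trans : ∀ {x y z} → x ≋ y → y ≋ z → x ≋ z
  ≋-trans {x} {y} {z} (mk≋ d) (mk≋ e) = mk≋ (subst (+ p ℤ.∣_) (lemma x y z) (ℤ.∣m∣n⇒∣m+n d e))
    where
    lemma : ∀ x y z → (x ℤ.- y) ℤ.+ (y ℤ.- z) ≡ x ℤ.- z
    lemma = ℤSolver.solve-∀

  +-cong : ∀ {x y u v} → x ≋ y → u ≋ v → x ℤ.+ u ≋ y ℤ.+ v
  +-cong {x} {y} {u} {v} (mk≋ d) (mk≋ e) = mk≋ (subst (+ p ℤ.∣_) (lemma x y u v) (ℤ.∣m∣n⇒∣m+n d e))
    where
    lemma : ∀ x y u v → (x ℤ.- y) ℤ.+ (u ℤ.- v) ≡ (x ℤ.+ u) ℤ.- (y ℤ.+ v)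
    lemma = ℤSolver.solve-∀

  -‿cong : ∀ {x y} → x ≋ y → ℤ.- x ≋ ℤ.- y
  -‿cong {x} {y} (mk≋ d) = mk≋ (subst (+ p ℤ.∣_) (lemma x y) (ℤ.∣m⇒∣-m d))
    where
    lemma : ∀ x y → ℤ.- (x ℤ.- y) ≡ ℤ.- x ℤ.- (ℤ.- y)
    lemma = ℤSolver.solve-∀

  *-cong : ∀ {x y u v} → x ≋ y → u ≋ v → x ℤ.* u ≋ y ℤ.* v
  *-cong {x} {y} {u} {v} (mk≋ d) (mk≋ e) =
    mk≋ (subst (+ p ℤ.∣_) (lemma x y u v) (ℤ.∣m∣n⇒∣m+n (ℤ.∣m⇒∣m*n u d) (ℤ.∣n⇒∣m*n y e)))
    where
    lemma : ∀ x y u v → (x ℤ.- y) ℤ.* u ℤ.+ y ℤ.* (u ℤ.- v) ≡ x ℤ.* u ℤ.- y ℤ.* v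
    lemma = ℤSolver.solve-∀

  p≋0 : + p ≋ + 0
  p≋0 = mk≋ (ℤ.divides (+ 1) (trans (ℤ.+-identityʳ (+ p)) (sym (ℤ.*-identityˡ (+ p)))))

  -- The carrier stays ℤ and only equality is coarsened, so every ring identity of integers carries
  -- over by `≋-reflexive`.
  ℤ/p : CommutativeRing 0ℓ 0ℓ
  ℤ/p = record
    { Carrier = ℤ ; _≈_ = _≋_ ; _+_ = ℤ._+_ ; _*_ = ℤ._*_ ; -_ = ℤ.-_ ; 0# = + 0 ; 1# = + 1
    ; isCommutativeRing = record
      { isRing = record
        { +-isAbelianGroup = record
          { isGroup = record
            { isMonoid = record
              { isSemigroup = record
                { isMagma = record
                  { isEquivalence = record { refl = ≋-reflexive refl ; sym = ≋-sym ; trans = ≋-trans }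
                  ; ∙-cong = +-cong }
                ; assoc = λ x y z → ≋-reflexive (ℤ.+-assoc x y z) }
              ; identity = (λ x → ≋-reflexive (ℤ.+-identityˡ x)) , (λ x → ≋-reflexive (ℤ.+-identityʳ x)) }
            ; inverse = (λ x → ≋-reflexive (ℤ.+-inverseˡ x)) , (λ x → ≋-reflexive (ℤ.+-inverseʳ x))
            ; ⁻¹-cong = -‿cong }
          ; comm = λ x y → ≋-reflexive (ℤ.+-comm x y) }
        ; *-cong = *-cong
        ; *-assoc = λ x y z → ≋-reflexive (ℤ.*-assoc x y z)
        ; *-identity = (λ x → ≋-reflexive (ℤ.*-identityˡ x)) , (λ x → ≋-reflexive (ℤ.*-identityʳ x))
        ; distrib = (λ x y z → ≋-reflexive (ℤ.*-distribˡ-+ x y z)) , (λ x y z → ≋-reflexive (ℤ.*-distribʳ-+ x y z)) }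
      ; *-comm = λ x y → ≋-reflexive (ℤ.*-comm x y) } }

  open CommutativeRing ℤ/p public
    using (semiring; commutativeSemiring; setoid)
    renaming (refl to ≋-refl)

  +-congˡ : ∀ x {y z} → y ≋ z → x ℤ.+ y ≋ x ℤ.+ z
  +-congˡ x = +-cong (≋-refl {x})

  +-congʳ : ∀ x {y z} → y ≋ z → y ℤ.+ x ≋ z ℤ.+ x
  +-congʳ x y≋z = +-cong y≋z (≋-refl {x})

  *-congˡ : ∀ x {y z} → y ≋ z → x ℤ.* y ≋ x ℤ.* z
  *-congˡ x = *-cong (≋-refl {x})

  open SetoidReasoning setoid

  ^-cong : ∀ {x y} → x ≋ y → ∀ n → x ℤ.^ n ≋ y ℤ.^ n
  ^-cong x≋y zero    = ≋-refl
  ^-cong x≋y (suc n) = *-cong x≋y (^-cong x≋y n)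

  x-y≋0⇒x≋y : ∀ {x y} → x ℤ.- y ≋ + 0 → x ≋ y
  x-y≋0⇒x≋y {x} {y} (mk≋ d) = mk≋ (subst (+ p ℤ.∣_) (ℤ.+-identityʳ (x ℤ.- y)) d)

  x≋y⇒x-y≋0 : ∀ {x y} → x ≋ y → x ℤ.- y ≋ + 0
  x≋y⇒x-y≋0 {x} {y} (mk≋ d) = mk≋ (subst (+ p ℤ.∣_) (sym (ℤ.+-identityʳ (x ℤ.- y))) d)

  ∣⇒≋0 : ∀ {x} → p ∣ ℤ.∣ x ∣ → x ≋ + 0
  ∣⇒≋0 {x} d = mk≋ (subst (+ p ℤ.∣_) (sym (ℤ.+-identityʳ x)) (ℤ.∣ᵤ⇒∣ d))

  ≋0⇒∣ : ∀ {x} → x ≋ + 0 → p ∣ ℤ.∣ x ∣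
  ≋0⇒∣ {x} (mk≋ d) = subst (λ x → p ∣ ℤ.∣ x ∣) (ℤ.+-identityʳ x) (ℤ.∣⇒∣ᵤ d)

  0<n<p⇒n≋̸0 : ∀ {n} → suc n < p → + suc n ≋̸0
  0<n<p⇒n≋̸0 n<p n≋0 = >⇒∤ n<p (≋0⇒∣ n≋0)

  -- Prime modulus: cancellation, Fermat's theorem, inverses and roots of polynomials

  module PrimeModulus (p-prime : Prime p) where

    private instance
      p≢0 = prime⇒nonZero p-prime

    *-≋0 : ∀ {x y} → x ℤ.* y ≋ + 0 → x ≋ + 0 ⊎ y ≋ + 0
    *-≋0 {x} {y} xy≋0 with euclidsLemma ℤ.∣ x ∣ ℤ.∣ y ∣ p-prime (subst (p ∣_) (ℤ.abs-* x y) (≋0⇒∣ xy≋0))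
    ... | inj₁ p∣x = inj₁ (∣⇒≋0 p∣x)
    ... | inj₂ p∣y = inj₂ (∣⇒≋0 p∣y)

    x*y≋0⇒y≋0 : ∀ {x y} → x ≋̸0 → x ℤ.* y ≋ + 0 → y ≋ + 0
    x*y≋0⇒y≋0 x≋̸0 xy≋0 with *-≋0 xy≋0
    ... | inj₁ x≋0 = contradiction x≋0 x≋̸0
    ... | inj₂ y≋0 = y≋0

    *-≋̸0 : ∀ {x y} → x ≋̸0 → y ≋̸0 → x ℤ.* y ≋̸0
    *-≋̸0 x≋̸0 y≋̸0 xy≋0 = y≋̸0 (x*y≋0⇒y≋0 x≋̸0 xy≋0)

    *-cancelˡ : ∀ {x y z} → x ≋̸0 → x ℤ.* y ≋ x ℤ.* z → y ≋ z
    *-cancelˡ {x} {y} {z} x≋̸0 xy≋xz =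
      x-y≋0⇒x≋y (x*y≋0⇒y≋0 x≋̸0 (≋-trans (≋-reflexive (lemma x y z)) (x≋y⇒x-y≋0 xy≋xz)))
      where
      lemma : ∀ x y z → x ℤ.* (y ℤ.- z) ≡ x ℤ.* y ℤ.- x ℤ.* z
      lemma = ℤSolver.solve-∀

    1≋̸0 : + 1 ≋̸0
    1≋̸0 = 0<n<p⇒n≋̸0 (ℕ.nonTrivial⇒n>1 p {{prime⇒nonTrivial p-prime}})

    ^-≋̸0 : ∀ {x} → x ≋̸0 → ∀ n → x ℤ.^ n ≋̸0
    ^-≋̸0 x≋̸0 zero    = 1≋̸0
    ^-≋̸0 x≋̸0 (suc n) = *-≋̸0 x≋̸0 (^-≋̸0 x≋̸0 n)

    open Exp semiring using () renaming (_^_ to _↑_)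
    open Mult semiring using () renaming (_×_ to _·_)

    private
      ↑≡^ : ∀ x n → x ↑ n ≡ x ℤ.^ n
      ↑≡^ x zero    = refl
      ↑≡^ x (suc n) = cong (x ℤ.*_) (↑≡^ x n)

      n·1≡n : ∀ n → n · + 1 ≡ + n
      n·1≡n zero    = refl
      n·1≡n (suc n) = cong (ℤ._+_ (+ 1)) (n·1≡n n)

    [x+y]^p≋x^p+y^p : ∀ x y → (x ℤ.+ y) ℤ.^ p ≋ x ℤ.^ p ℤ.+ y ℤ.^ p
    [x+y]^p≋x^p+y^p x y = begin
      (x ℤ.+ y) ℤ.^ p        ≡⟨ ↑≡^ (x ℤ.+ y) p ⟨
      (x ℤ.+ y) ↑ p          ≈⟨ Frobenius.frobenius commutativeSemiring p-prime
                                  (≋-trans (≋-reflexive (n·1≡n p)) p≋0) x y ⟩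
      x ↑ p ℤ.+ y ↑ p        ≡⟨ cong₂ ℤ._+_ (↑≡^ x p) (↑≡^ y p) ⟩
      x ℤ.^ p ℤ.+ y ℤ.^ p    ∎

    -- The remainder modulo p is a natural number, and on natural numbers the claim follows by
    -- induction from (1 + n)^p ≡ 1 + n^p.
    fermat : ∀ x → x ℤ.^ p ≋ x
    fermat x = begin
      x ℤ.^ p                 ≈⟨ ^-cong x≋x%p p ⟩
      (+ (x ℤ.%ℕ p)) ℤ.^ p    ≈⟨ fermat-ℕ (x ℤ.%ℕ p) ⟩
      + (x ℤ.%ℕ p)            ≈⟨ x≋x%p ⟨
      x                       ∎
      where
      0^p : ∀ n → .{{ℕ.NonZero n}} → (+ 0) ℤ.^ n ≡ + 0
      0^p (suc n) = refl

      fermat-ℕ : ∀ n → (+ n) ℤ.^ p ≋ + n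
      fermat-ℕ zero    = ≋-reflexive (0^p p)
      fermat-ℕ (suc n) = begin
        (+ 1 ℤ.+ + n) ℤ.^ p               ≈⟨ [x+y]^p≋x^p+y^p (+ 1) (+ n) ⟩
        (+ 1) ℤ.^ p ℤ.+ (+ n) ℤ.^ p       ≈⟨ +-cong (≋-reflexive (ℤ.^-zeroˡ p)) (fermat-ℕ n) ⟩
        + 1 ℤ.+ + n                       ∎

      x≋x%p : x ≋ + (x ℤ.%ℕ p)
      x≋x%p = begin
        x                                              ≡⟨ ℤ.a≡a%ℕn+[a/ℕn]*n x p ⟩
        + (x ℤ.%ℕ p) ℤ.+ (x ℤ./ℕ p) ℤ.* + p            ≈⟨ +-congˡ (+ (x ℤ.%ℕ p)) (*-congˡ (x ℤ./ℕ p) p≋0) ⟩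
        + (x ℤ.%ℕ p) ℤ.+ (x ℤ./ℕ p) ℤ.* + 0            ≡⟨ cong (ℤ._+_ (+ (x ℤ.%ℕ p))) (ℤ.*-zeroʳ (x ℤ./ℕ p)) ⟩
        + (x ℤ.%ℕ p) ℤ.+ + 0                           ≡⟨ ℤ.+-identityʳ _ ⟩
        + (x ℤ.%ℕ p)                                   ∎

    fermat-unit : ∀ {x n} → suc n ≡ p → x ≋̸0 → x ℤ.^ n ≋ + 1
    fermat-unit {x} refl x≋̸0 = *-cancelˡ x≋̸0 (≋-trans (fermat x) (≋-reflexive (sym (ℤ.*-identityʳ x))))

    inverse : ∀ {x} → x ≋̸0 → ∃ λ x⁻¹ → x ℤ.* x⁻¹ ≋ + 1
    inverse {x} x≋̸0 = go p refl
      where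
      go : ∀ n → n ≡ p → ∃ λ x⁻¹ → x ℤ.* x⁻¹ ≋ + 1
      go zero          refl = contradiction p-prime λ ()
      go (suc zero)    refl = contradiction p-prime λ ()
      -- Here p = n + 2, so the inverse is x^(p-2).
      go (suc (suc n)) refl = x ℤ.^ n , fermat-unit refl x≋̸0

    -- Polynomial c d f says that f is a polynomial function of degree at most d
    -- with coefficient c at x^d, expressed by iterated divided differences.
    Polynomial : ℤ → ℕ → (ℤ → ℤ) → Set
    Polynomial c zero    f = ∀ x → f x ≋ c
    Polynomial c (suc d) f = ∀ r → ∃ λ g → Polynomial c d g × (∀ x → f x ℤ.- f r ≋ (x ℤ.- r) ℤ.* g x)

    Polynomial-+ : ∀ {c e f g} d → Polynomial c d f → Polynomial e d g →
                   Polynomial (c ℤ.+ e) d (λ x → f x ℤ.+ g x)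
    Polynomial-+ zero f-poly g-poly x = +-cong (f-poly x) (g-poly x)
    Polynomial-+ {f = f} {g} (suc d) f-poly g-poly r with f-poly r | g-poly r
    ... | f′ , f′-poly , f-eq | g′ , g′-poly , g-eq =
      _ , Polynomial-+ d f′-poly g′-poly , λ x → begin
        (f x ℤ.+ g x) ℤ.- (f r ℤ.+ g r)                          ≡⟨ lemma₁ (f x) (g x) (f r) (g r) ⟩
        (f x ℤ.- f r) ℤ.+ (g x ℤ.- g r)                          ≈⟨ +-cong (f-eq x) (g-eq x) ⟩
        (x ℤ.- r) ℤ.* f′ x ℤ.+ (x ℤ.- r) ℤ.* g′ x                ≡⟨ ℤ.*-distribˡ-+ (x ℤ.- r) (f′ x) (g′ x) ⟨
        (x ℤ.- r) ℤ.* (f′ x ℤ.+ g′ x)                            ∎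
      where
      lemma₁ : ∀ a b c d → (a ℤ.+ b) ℤ.- (c ℤ.+ d) ≡ (a ℤ.- c) ℤ.+ (b ℤ.- d)
      lemma₁ = ℤSolver.solve-∀

    Polynomial-scale : ∀ {c f} d s → Polynomial c d f → Polynomial (s ℤ.* c) d (λ x → s ℤ.* f x)
    Polynomial-scale zero s f-poly x = *-congˡ s (f-poly x)
    Polynomial-scale {f = f} (suc d) s f-poly r with f-poly r
    ... | f′ , f′-poly , f-eq = _ , Polynomial-scale d s f′-poly , λ x → begin
        s ℤ.* f x ℤ.- s ℤ.* f r         ≡⟨ lemma₁ s (f x) (f r) ⟩
        s ℤ.* (f x ℤ.- f r)             ≈⟨ *-congˡ s (f-eq x) ⟩
        s ℤ.* ((x ℤ.- r) ℤ.* f′ x)      ≡⟨ lemma₂ s (x ℤ.- r) (f′ x) ⟩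
        (x ℤ.- r) ℤ.* (s ℤ.* f′ x)      ∎
      where
      lemma₁ : ∀ s a b → s ℤ.* a ℤ.- s ℤ.* b ≡ s ℤ.* (a ℤ.- b)
      lemma₁ = ℤSolver.solve-∀
      lemma₂ : ∀ s a b → s ℤ.* (a ℤ.* b) ≡ a ℤ.* (s ℤ.* b)
      lemma₂ = ℤSolver.solve-∀

    -- Adjusts degree bounds in `Polynomial-shift`, where `f′` has one degree less than the `f` it
    -- is added to; the padded leading coefficient 0 leaves `c` unchanged.
    Polynomial-raise : ∀ {c f} d → Polynomial c d f → Polynomial (+ 0) (suc d) f
    Polynomial-raise {c} {f} zero f-poly r = (λ _ → + 0) , (λ _ → ≋-refl) , λ x → begin
      f x ℤ.- f r           ≈⟨ +-cong (f-poly x) (-‿cong (f-poly r)) ⟩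
      c ℤ.- c               ≡⟨ ℤ.+-inverseʳ c ⟩
      + 0                   ≡⟨ ℤ.*-zeroʳ (x ℤ.- r) ⟨
      (x ℤ.- r) ℤ.* + 0     ∎
    Polynomial-raise (suc d) f-poly r with f-poly r
    ... | f′ , f′-poly , f-eq = f′ , Polynomial-raise d f′-poly , f-eq

    -- The divided difference comes from x f(x) - r f(r) = (x - r) f(x) + r (f(x) - f(r)).
    Polynomial-shift : ∀ {c f} d → Polynomial c d f → Polynomial c (suc d) (λ x → x ℤ.* f x)
    Polynomial-shift {c} {f} zero f-poly r = f , f-poly , λ x → begin
      x ℤ.* f x ℤ.- r ℤ.* f r  ≈⟨ +-congˡ (x ℤ.* f x) (-‿cong (*-congˡ r (≋-trans (f-poly r) (≋-sym (f-poly x))))) ⟩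
      x ℤ.* f x ℤ.- r ℤ.* f x  ≡⟨ lemma₁ x r (f x) ⟩
      (x ℤ.- r) ℤ.* f x        ∎
      where
      lemma₁ : ∀ x r a → x ℤ.* a ℤ.- r ℤ.* a ≡ (x ℤ.- r) ℤ.* a
      lemma₁ = ℤSolver.solve-∀
    Polynomial-shift {c} {f} (suc d) f-poly r with f-poly r
    ... | f′ , f′-poly , f-eq =
      (λ x → f x ℤ.+ r ℤ.* f′ x) ,
      subst (λ e → Polynomial e (suc d) (λ x → f x ℤ.+ r ℤ.* f′ x)) (ℤ.+-identityʳ c)
        (Polynomial-+ {f = f} {λ x → r ℤ.* f′ x} (suc d) f-poly
          (Polynomial-raise {f = λ x → r ℤ.* f′ x} d (Polynomial-scale {f = f′} d r f′-poly))) ,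
      λ x → begin
        x ℤ.* f x ℤ.- r ℤ.* f r                                 ≡⟨ lemma₁ x r (f x) (f r) ⟩
        (x ℤ.- r) ℤ.* f x ℤ.+ r ℤ.* (f x ℤ.- f r)               ≈⟨ +-congˡ ((x ℤ.- r) ℤ.* f x) (*-congˡ r (f-eq x)) ⟩
        (x ℤ.- r) ℤ.* f x ℤ.+ r ℤ.* ((x ℤ.- r) ℤ.* f′ x)        ≡⟨ lemma₂ (x ℤ.- r) r (f x) (f′ x) ⟩
        (x ℤ.- r) ℤ.* (f x ℤ.+ r ℤ.* f′ x)                      ∎
      where
      lemma₁ : ∀ x r a b → x ℤ.* a ℤ.- r ℤ.* b ≡ (x ℤ.- r) ℤ.* a ℤ.+ r ℤ.* (a ℤ.- b)
      lemma₁ = ℤSolver.solve-∀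
      lemma₂ : ∀ y r a b → y ℤ.* a ℤ.+ r ℤ.* (y ℤ.* b) ≡ y ℤ.* (a ℤ.+ r ℤ.* b)
      lemma₂ = ℤSolver.solve-∀

    Polynomial-^ : ∀ d → Polynomial (+ 1) d (ℤ._^ d)
    Polynomial-^ zero    x = ≋-refl
    Polynomial-^ (suc d)   = Polynomial-shift d (Polynomial-^ d)

    -- Dividing out the last root leaves a divided difference of degree one less with the same
    -- leading coefficient. It still vanishes at the other roots, because their differences from the
    -- last one can be cancelled. In degree 0 a root would make `c` vanish.
    lagrange : ∀ {c f} d → c ≋̸0 → Polynomial c d f → (root : ℕ → ℤ) →
               (∀ {i j} → i < j → j ≤ d → ¬ (root i ≋ root j)) →
               ¬ (∀ {i} → i ≤ d → f (root i) ≋ + 0)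
    lagrange zero c≋̸0 f-poly root distinct f-root =
      c≋̸0 (≋-trans (≋-sym (f-poly (root 0))) (f-root z≤n))
    lagrange {f = f} (suc d) c≋̸0 f-poly root distinct f-root with f-poly (root (suc d))
    ... | g , g-poly , f-eq =
      lagrange d c≋̸0 g-poly root (λ i<j j≤d → distinct i<j (ℕ.m≤n⇒m≤1+n j≤d)) g-root
      where
      g-root : ∀ {i} → i ≤ d → g (root i) ≋ + 0
      g-root {i} i≤d = x*y≋0⇒y≋0 (λ eq → distinct (s≤s i≤d) ℕ.≤-refl (x-y≋0⇒x≋y eq)) (begin
        (root i ℤ.- root (suc d)) ℤ.* g (root i) ≈⟨ f-eq (root i) ⟨
        f (root i) ℤ.- f (root (suc d))          ≈⟨ +-cong (f-root (ℕ.m≤n⇒m≤1+n i≤d)) (-‿cong (f-root ℕ.≤-refl)) ⟩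
        + 0                                      ∎)

    -- Euler's criterion

    module _ (h : ℕ) (2h+1≡p : suc (2 ℕ.* h) ≡ p) where

      euler-residue : ∀ {x D} → D ≋̸0 → x ℤ.* x ≋ D → D ℤ.^ h ≋ + 1
      euler-residue {x} {D} D≋̸0 x²≋D = begin
        D ℤ.^ h             ≈⟨ ^-cong x²≋D h ⟨
        (x ℤ.* x) ℤ.^ h     ≡⟨ cong (λ y → (x ℤ.* y) ℤ.^ h) (ℤ.*-identityʳ x) ⟨
        (x ℤ.^ 2) ℤ.^ h     ≡⟨ ℤ.^-*-assoc x 2 h ⟩
        x ℤ.^ (2 ℕ.* h)     ≈⟨ fermat-unit 2h+1≡p x≋̸0 ⟩
        + 1                 ∎
        where
        x≋̸0 : x ≋̸0
        x≋̸0 x≋0 = D≋̸0 (≋-trans (≋-sym x²≋D) (*-cong x≋0 x≋0))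

      -- With j = i + 1 + k the difference of the squares is (k + 1)(i + j + 2), and j < h keeps
      -- both factors strictly between 0 and p = 2h + 1.
      squares-distinct : ∀ {i j} → i < j → j < h → ¬ (+ suc i ℤ.* + suc i ≋ + suc j ℤ.* + suc j)
      squares-distinct {i} {j} i<j j<h eq with ℕ.m≤n⇒∃[o]m+o≡n i<j
      ... | k , refl = *-≋̸0 (0<n<p⇒n≋̸0 {k} small₁) (0<n<p⇒n≋̸0 {suc (i + j)} small₂)
              (≋-trans (≋-reflexive (lemma (+ i) (+ k))) (x≋y⇒x-y≋0 (≋-sym eq)))
        where
        lemma : ∀ i k → (+ 1 ℤ.+ k) ℤ.* (+ 1 ℤ.+ (+ 1 ℤ.+ (i ℤ.+ (+ 1 ℤ.+ (i ℤ.+ k))))) ≡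
                (+ 1 ℤ.+ (+ 1 ℤ.+ (i ℤ.+ k))) ℤ.* (+ 1 ℤ.+ (+ 1 ℤ.+ (i ℤ.+ k))) ℤ.- (+ 1 ℤ.+ i) ℤ.* (+ 1 ℤ.+ i)
        lemma = ℤSolver.solve-∀
        j+h<p : j + h < p
        j+h<p = subst (j + h <_) 2h+1≡p (s≤s (ℕ.≤-trans (ℕ.+-monoˡ-≤ h (ℕ.<⇒≤ j<h)) (ℕ.+-monoʳ-≤ h (ℕ.m≤m+n h 0))))
        small₁ : suc k < p
        small₁ = ℕ.≤-<-trans (ℕ.≤-trans (s≤s (ℕ.m≤n+m k i)) (ℕ.m≤m+n j h)) j+h<p
        small₂ : suc (suc (i + j)) < p
        small₂ = subst (suc (suc (i + j)) <_) 2h+1≡p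
          (s≤s (ℕ.≤-trans (s≤s (ℕ.+-monoˡ-≤ j i<j)) (ℕ.+-mono-≤ j<h (ℕ.≤-trans (ℕ.<⇒≤ j<h) (ℕ.m≤m+n h 0)))))

      -- D is nonzero because 0 is a square, so Fermat gives t² ≡ 1 for t = D^h. In (t - 1)(t + 1) ≡
      -- 0 the first factor cancels once t ≡ 1 is excluded.
      euler-nonresidue : ∀ {D} → (∀ x → ¬ (x ℤ.* x ≋ D)) → D ℤ.^ h ≋ ℤ.- + 1
      euler-nonresidue {D} nonresidue = x-y≋0⇒x≋y (x*y≋0⇒y≋0 (λ eq → D^h≋̸1 h refl (x-y≋0⇒x≋y eq)) (begin
          (t ℤ.- + 1) ℤ.* (t ℤ.+ + 1)  ≡⟨ lemma t ⟩
          t ℤ.* t ℤ.- + 1              ≡⟨ cong (ℤ._- + 1) (trans (sym (ℤ.^-distribˡ-+-* D h h))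
                                         (cong (λ n → D ℤ.^ (h + n)) (sym (ℕ.+-identityʳ h)))) ⟩
          D ℤ.^ (2 ℕ.* h) ℤ.- + 1      ≈⟨ +-congʳ (ℤ.- + 1) (fermat-unit 2h+1≡p D≋̸0) ⟩
          + 0                          ∎))
        where
        t = D ℤ.^ h
        lemma : ∀ t → (t ℤ.- + 1) ℤ.* (t ℤ.+ + 1) ≡ t ℤ.* t ℤ.- + 1
        lemma = ℤSolver.solve-∀
        D≋̸0 : D ≋̸0
        D≋̸0 D≋0 = nonresidue (+ 0) (≋-sym D≋0)

        -- Otherwise D would be an (h+1)-st root of x^h - 1, besides 1², …, h².
        D^h≋̸1 : ∀ k → k ≡ h → ¬ (D ℤ.^ k ≋ + 1)
        D^h≋̸1 zero    refl _ = contradiction (subst Prime (sym 2h+1≡p) p-prime) λ ()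
        D^h≋̸1 (suc k) refl D^h≋1 with Polynomial-^ h D
        -- The root D is divided out beforehand: `g` has degree k = h - 1 and leading coefficient 1,
        -- but would vanish at h distinct squares.
        ... | g , g-poly , eq = lagrange k 1≋̸0 g-poly square (λ i<j j≤k → squares-distinct i<j (s≤s j≤k)) g-root
          where
          square : ℕ → ℤ
          square i = + suc i ℤ.* + suc i
          g-root : ∀ {i} → i ≤ k → g (square i) ≋ + 0
          g-root {i} i≤k = x*y≋0⇒y≋0 (λ i²-D≋0 → nonresidue (+ suc i) (x-y≋0⇒x≋y i²-D≋0)) (begin
            (square i ℤ.- D) ℤ.* g (square i)  ≈⟨ eq (square i) ⟨
            square i ℤ.^ h ℤ.- D ℤ.^ h         ≈⟨ +-cong (euler-residue {+ suc i} (*-≋̸0 i≋̸0 i≋̸0) ≋-refl) (-‿cong D^h≋1) ⟩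
            + 0                                ∎)
            where
            i≋̸0 : + suc i ≋̸0
            i≋̸0 = 0<n<p⇒n≋̸0 (subst (suc i <_) 2h+1≡p (s≤s (ℕ.≤-trans (s≤s i≤k) (ℕ.m≤m+n h _))))

-- Lucas sequences as coefficients in a quadratic extension

lucas : ℕ → ℤ → ℤ → ℤ
lucas zero          P Q = + 0
lucas (suc zero)    P Q = + 1
lucas (suc (suc n)) P Q = P ℤ.* lucas (suc n) P Q ℤ.- Q ℤ.* lucas n P Q

-- The ring (ℤ/p)[X]/(X² - PX + Q), with u + vX represented by (u , v).
module QuadraticExtension (p : ℕ) (P Q : ℤ) where
  open Congruence p

  infix  4 _≈_ _&_
  infixl 6 _⊕_
  infixl 7 _⊗_

  record _≈_ (x y : ℤ × ℤ) : Set where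
    constructor _&_
    field
      ≈₁ : proj₁ x ≋ proj₁ y
      ≈₂ : proj₂ x ≋ proj₂ y

  open _≈_

  _⊕_ _⊗_ : ℤ × ℤ → ℤ × ℤ → ℤ × ℤ
  (u , v) ⊕ (u′ , v′) = (u ℤ.+ u′ , v ℤ.+ v′)
  (u , v) ⊗ (u′ , v′) = (u ℤ.* u′ ℤ.- Q ℤ.* (v ℤ.* v′) , u ℤ.* v′ ℤ.+ v ℤ.* u′ ℤ.+ P ℤ.* (v ℤ.* v′))

  ι : ℤ → ℤ × ℤ
  ι x = x , + 0

  ≡⇒≈ : ∀ {u v u′ v′} → u ≡ u′ → v ≡ v′ → (u , v) ≈ (u′ , v′)
  ≡⇒≈ eq₁ eq₂ = ≋-reflexive eq₁ & ≋-reflexive eq₂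

  ⊗-assoc : ∀ x y z → (x ⊗ y) ⊗ z ≈ x ⊗ (y ⊗ z)
  ⊗-assoc (u , v) (u′ , v′) (u″ , v″) = ≡⇒≈ (lemma₁ P Q u v u′ v′ u″ v″) (lemma₂ P Q u v u′ v′ u″ v″)
    where
    lemma₁ : ∀ P Q u v u′ v′ u″ v″ →
      (u ℤ.* u′ ℤ.- Q ℤ.* (v ℤ.* v′)) ℤ.* u″ ℤ.- Q ℤ.* ((u ℤ.* v′ ℤ.+ v ℤ.* u′ ℤ.+ P ℤ.* (v ℤ.* v′)) ℤ.* v″) ≡
      u ℤ.* (u′ ℤ.* u″ ℤ.- Q ℤ.* (v′ ℤ.* v″)) ℤ.- Q ℤ.* (v ℤ.* (u′ ℤ.* v″ ℤ.+ v′ ℤ.* u″ ℤ.+ P ℤ.* (v′ ℤ.* v″)))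
    lemma₁ = ℤSolver.solve-∀
    lemma₂ : ∀ P Q u v u′ v′ u″ v″ →
      (u ℤ.* u′ ℤ.- Q ℤ.* (v ℤ.* v′)) ℤ.* v″ ℤ.+ (u ℤ.* v′ ℤ.+ v ℤ.* u′ ℤ.+ P ℤ.* (v ℤ.* v′)) ℤ.* u″
        ℤ.+ P ℤ.* ((u ℤ.* v′ ℤ.+ v ℤ.* u′ ℤ.+ P ℤ.* (v ℤ.* v′)) ℤ.* v″) ≡
      u ℤ.* (u′ ℤ.* v″ ℤ.+ v′ ℤ.* u″ ℤ.+ P ℤ.* (v′ ℤ.* v″)) ℤ.+ v ℤ.* (u′ ℤ.* u″ ℤ.- Q ℤ.* (v′ ℤ.* v″))
        ℤ.+ P ℤ.* (v ℤ.* (u′ ℤ.* v″ ℤ.+ v′ ℤ.* u″ ℤ.+ P ℤ.* (v′ ℤ.* v″)))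
    lemma₂ = ℤSolver.solve-∀

  ⊗-comm : ∀ x y → x ⊗ y ≈ y ⊗ x
  ⊗-comm (u , v) (u′ , v′) = ≡⇒≈ (lemma₁ Q u v u′ v′) (lemma₂ P u v u′ v′)
    where
    lemma₁ : ∀ Q u v u′ v′ → u ℤ.* u′ ℤ.- Q ℤ.* (v ℤ.* v′) ≡ u′ ℤ.* u ℤ.- Q ℤ.* (v′ ℤ.* v)
    lemma₁ = ℤSolver.solve-∀
    lemma₂ : ∀ P u v u′ v′ → u ℤ.* v′ ℤ.+ v ℤ.* u′ ℤ.+ P ℤ.* (v ℤ.* v′) ≡ u′ ℤ.* v ℤ.+ v′ ℤ.* u ℤ.+ P ℤ.* (v′ ℤ.* v)
    lemma₂ = ℤSolver.solve-∀

  ι-cong : ∀ {x y} → x ≋ y → ι x ≈ ι y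
  ι-cong eq = eq & ≋-refl

  ι-⊗ : ∀ c x → ι c ⊗ x ≡ (c ℤ.* proj₁ x , c ℤ.* proj₂ x)
  ι-⊗ c (u , v) = cong₂ _,_ (lemma₁ Q c u v) (lemma₂ P c u v)
    where
    lemma₁ : ∀ Q c u v → c ℤ.* u ℤ.- Q ℤ.* (+ 0 ℤ.* v) ≡ c ℤ.* u
    lemma₁ = ℤSolver.solve-∀
    lemma₂ : ∀ P c u v → c ℤ.* v ℤ.+ + 0 ℤ.* u ℤ.+ P ℤ.* (+ 0 ℤ.* v) ≡ c ℤ.* v
    lemma₂ = ℤSolver.solve-∀

  ⊗-distribˡ : ∀ x y z → x ⊗ (y ⊕ z) ≈ x ⊗ y ⊕ x ⊗ z
  ⊗-distribˡ (u , v) (u′ , v′) (u″ , v″) = ≡⇒≈ (lemma₁ Q u v u′ v′ u″ v″) (lemma₂ P u v u′ v′ u″ v″)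
    where
    lemma₁ : ∀ Q u v u′ v′ u″ v″ →
      u ℤ.* (u′ ℤ.+ u″) ℤ.- Q ℤ.* (v ℤ.* (v′ ℤ.+ v″)) ≡
      (u ℤ.* u′ ℤ.- Q ℤ.* (v ℤ.* v′)) ℤ.+ (u ℤ.* u″ ℤ.- Q ℤ.* (v ℤ.* v″))
    lemma₁ = ℤSolver.solve-∀
    lemma₂ : ∀ P u v u′ v′ u″ v″ →
      u ℤ.* (v′ ℤ.+ v″) ℤ.+ v ℤ.* (u′ ℤ.+ u″) ℤ.+ P ℤ.* (v ℤ.* (v′ ℤ.+ v″)) ≡
      (u ℤ.* v′ ℤ.+ v ℤ.* u′ ℤ.+ P ℤ.* (v ℤ.* v′)) ℤ.+ (u ℤ.* v″ ℤ.+ v ℤ.* u″ ℤ.+ P ℤ.* (v ℤ.* v″))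
    lemma₂ = ℤSolver.solve-∀

  ≈-trans : ∀ {x y z} → x ≈ y → y ≈ z → x ≈ z
  ≈-trans (eq₁ & eq₂) (eq₁′ & eq₂′) = ≋-trans eq₁ eq₁′ & ≋-trans eq₂ eq₂′

  ≈-reflexive : ∀ {x y} → x ≡ y → x ≈ y
  ≈-reflexive refl = ≋-refl & ≋-refl

  ⊕-cong : ∀ {x y z w} → x ≈ y → z ≈ w → x ⊕ z ≈ y ⊕ w
  ⊕-cong (a & b) (c & d) = +-cong a c & +-cong b d

  ⊗-identityˡ : ∀ x → ι (+ 1) ⊗ x ≈ x
  ⊗-identityˡ x@(u , v) = ≈-trans (≈-reflexive (ι-⊗ (+ 1) x)) (≡⇒≈ (ℤ.*-identityˡ u) (ℤ.*-identityˡ v))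

  ⊗-cong : ∀ {x y z w} → x ≈ y → z ≈ w → x ⊗ z ≈ y ⊗ w
  ⊗-cong (a & b) (c & d) =
    +-cong (*-cong a c) (-‿cong (*-congˡ Q (*-cong b d))) &
    +-cong (+-cong (*-cong a d) (*-cong b c)) (*-congˡ P (*-cong b d))

  ⊗-congˡ : ∀ x {y z} → y ≈ z → x ⊗ y ≈ x ⊗ z
  ⊗-congˡ x = ⊗-cong (≈-reflexive {x} refl)

  ⊗-congʳ : ∀ x {y z} → y ≈ z → y ⊗ x ≈ z ⊗ x
  ⊗-congʳ x y≈z = ⊗-cong y≈z (≈-reflexive {x} refl)

  commutativeRing : CommutativeRing 0ℓ 0ℓ
  commutativeRing = record
    { Carrier = ℤ × ℤ ; _≈_ = _≈_ ; _+_ = _⊕_ ; _*_ = _⊗_ ; -_ = λ (u , v) → (ℤ.- u , ℤ.- v)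
    ; 0# = ι (+ 0) ; 1# = ι (+ 1)
    ; isCommutativeRing = record
      { isRing = record
        { +-isAbelianGroup = record
          { isGroup = record
            { isMonoid = record
              { isSemigroup = record
                { isMagma = record
                  { isEquivalence = record
                    { refl = ≋-refl & ≋-refl
                    ; sym = λ (eq₁ & eq₂) → ≋-sym eq₁ & ≋-sym eq₂
                    ; trans = ≈-trans }
                  ; ∙-cong = ⊕-cong }
                ; assoc = λ (u , v) (u′ , v′) (u″ , v″) → ≡⇒≈ (ℤ.+-assoc u u′ u″) (ℤ.+-assoc v v′ v″) }
              ; identity = (λ (u , v) → ≡⇒≈ (ℤ.+-identityˡ u) (ℤ.+-identityˡ v))
                         , (λ (u , v) → ≡⇒≈ (ℤ.+-identityʳ u) (ℤ.+-identityʳ v)) }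
            ; inverse = (λ (u , v) → ≡⇒≈ (ℤ.+-inverseˡ u) (ℤ.+-inverseˡ v))
                      , (λ (u , v) → ≡⇒≈ (ℤ.+-inverseʳ u) (ℤ.+-inverseʳ v))
            ; ⁻¹-cong = λ (a & b) → -‿cong a & -‿cong b }
          ; comm = λ (u , v) (u′ , v′) → ≡⇒≈ (ℤ.+-comm u u′) (ℤ.+-comm v v′) }
        ; *-cong = ⊗-cong
        ; *-assoc = ⊗-assoc
        ; *-identity = ⊗-identityˡ , λ x → ≈-trans (⊗-comm x (ι (+ 1))) (⊗-identityˡ x)
        ; distrib = ⊗-distribˡ , λ x y z → ≈-trans (⊗-comm (y ⊕ z) x)
            (≈-trans (⊗-distribˡ x y z) (⊕-cong (⊗-comm x y) (⊗-comm x z))) }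
      ; *-comm = ⊗-comm } }

  private module E = CommutativeRing commutativeRing
  open CommutativeExp E.commutativeSemiring
    renaming (_^_ to _↑_; ^-congˡ to ↑-congˡ; ^-distrib-* to ↑-distrib-⊗; ^-homo-* to ↑-homo-⊗; ^-assocʳ to ↑-assocʳ)
  open Mult E.semiring using () renaming (_×_ to _·_)
  open SetoidReasoning E.setoid

  -- `X` is α and `Y` = P - X is β. Their difference `δ` = 2X - P is a square root of D that lies in
  -- the ring whether or not D is a square modulo p.
  X Y δ : ℤ × ℤ
  X = + 0 , + 1
  Y = P , ℤ.- + 1
  δ = ℤ.- P , + 2

  discriminant : ℤ
  discriminant = P ℤ.* P ℤ.- + 4 ℤ.* Q

  δ⊗δ≈D : δ ⊗ δ ≈ ι discriminant
  δ⊗δ≈D = ≡⇒≈ (lemma₁ P Q) (lemma₂ P)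
    where
    lemma₁ : ∀ P Q → ℤ.- P ℤ.* ℤ.- P ℤ.- Q ℤ.* + 4 ≡ P ℤ.* P ℤ.- + 4 ℤ.* Q
    lemma₁ = ℤSolver.solve-∀
    lemma₂ : ∀ P → ℤ.- P ℤ.* + 2 ℤ.+ + 2 ℤ.* ℤ.- P ℤ.+ P ℤ.* + 4 ≡ + 0
    lemma₂ = ℤSolver.solve-∀

  X⊗Y≈Q : X ⊗ Y ≈ ι Q
  X⊗Y≈Q = ≡⇒≈ (lemma₁ P Q) (lemma₂ P)
    where
    lemma₁ : ∀ P Q → + 0 ℤ.* P ℤ.- Q ℤ.* ℤ.- + 1 ≡ Q
    lemma₁ = ℤSolver.solve-∀
    lemma₂ : ∀ P → + 0 ℤ.* ℤ.- + 1 ℤ.+ + 1 ℤ.* P ℤ.+ P ℤ.* ℤ.- + 1 ≡ + 0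
    lemma₂ = ℤSolver.solve-∀

  ι-↑ : ∀ x n → ι x ↑ n ≡ ι (x ℤ.^ n)
  ι-↑ x zero    = refl
  ι-↑ x (suc n) rewrite ι-↑ x n = trans (ι-⊗ x (ι (x ℤ.^ n))) (cong (x ℤ.* x ℤ.^ n ,_) (ℤ.*-zeroʳ x))

  X↑n : ∀ n → X ↑ n ≡ (lucas (suc n) P Q ℤ.- P ℤ.* lucas n P Q , lucas n P Q)
  X↑n zero    = cong (_, + 0) (lemma P)
    where
    lemma : ∀ P → + 1 ≡ + 1 ℤ.- P ℤ.* + 0
    lemma = ℤSolver.solve-∀
  X↑n (suc n) rewrite X↑n n =
    cong₂ _,_ (lemma₁ P Q (lucas (suc n) P Q) (lucas n P Q)) (lemma₂ P (lucas (suc n) P Q) (lucas n P Q))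
    where
    lemma₁ : ∀ P Q a b → + 0 ℤ.* (a ℤ.- P ℤ.* b) ℤ.- Q ℤ.* (+ 1 ℤ.* b) ≡ P ℤ.* a ℤ.- Q ℤ.* b ℤ.- P ℤ.* a
    lemma₁ = ℤSolver.solve-∀
    lemma₂ : ∀ P a b → + 0 ℤ.* b ℤ.+ + 1 ℤ.* (a ℤ.- P ℤ.* b) ℤ.+ P ℤ.* (+ 1 ℤ.* b) ≡ a
    lemma₂ = ℤSolver.solve-∀

  -- The conjugate of `X↑n`: replacing X by P - X cancels the multiple of P and flips the sign of
  -- the other coefficient.
  Y↑n : ∀ n → Y ↑ n ≡ (lucas (suc n) P Q , ℤ.- lucas n P Q)
  Y↑n zero    = refl
  Y↑n (suc n) rewrite Y↑n n =
    cong₂ _,_ (lemma₁ P Q (lucas (suc n) P Q) (lucas n P Q)) (lemma₂ P (lucas (suc n) P Q) (lucas n P Q))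
    where
    lemma₁ : ∀ P Q a b → P ℤ.* a ℤ.- Q ℤ.* (ℤ.- + 1 ℤ.* ℤ.- b) ≡ P ℤ.* a ℤ.- Q ℤ.* b
    lemma₁ = ℤSolver.solve-∀
    lemma₂ : ∀ P a b → P ℤ.* ℤ.- b ℤ.+ ℤ.- + 1 ℤ.* a ℤ.+ P ℤ.* (ℤ.- + 1 ℤ.* ℤ.- b) ≡ ℤ.- a
    lemma₂ = ℤSolver.solve-∀

  Q^i⊗X↑j : ∀ i j → ι (Q ℤ.^ i) ⊗ X ↑ j ≈ Y ↑ i ⊗ X ↑ (i + j)
  Q^i⊗X↑j i j = begin
    ι (Q ℤ.^ i) ⊗ X ↑ j       ≡⟨ cong (_⊗ X ↑ j) (ι-↑ Q i) ⟨
    ι Q ↑ i ⊗ X ↑ j           ≈⟨ ⊗-congʳ (X ↑ j) (↑-congˡ i (E.trans (E.sym X⊗Y≈Q) (⊗-comm X Y))) ⟩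
    (Y ⊗ X) ↑ i ⊗ X ↑ j       ≈⟨ ⊗-congʳ (X ↑ j) (↑-distrib-⊗ Y X i) ⟩
    Y ↑ i ⊗ X ↑ i ⊗ X ↑ j     ≈⟨ ⊗-assoc (Y ↑ i) (X ↑ i) (X ↑ j) ⟩
    Y ↑ i ⊗ (X ↑ i ⊗ X ↑ j)   ≈⟨ ⊗-congˡ (Y ↑ i) (↑-homo-⊗ X i j) ⟨
    Y ↑ i ⊗ X ↑ (i + j)       ∎

  -- The coefficient of X is U_j in α^j but -U_i in β^i; this is the source of the minus sign in
  -- both reflection formulas.
  second-coordinate : ∀ c d i j → ι c ⊗ X ↑ j ≈ ι d ⊗ Y ↑ i → c ℤ.* lucas j P Q ≋ ℤ.- (d ℤ.* lucas i P Q)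
  second-coordinate c d i j eq = ≋-trans (≈₂ eq′) (≋-reflexive (sym (ℤ.neg-distribʳ-* d (lucas i P Q))))
    where
    eq′ : (c ℤ.* (lucas (suc j) P Q ℤ.- P ℤ.* lucas j P Q) , c ℤ.* lucas j P Q) ≈
          (d ℤ.* lucas (suc i) P Q , d ℤ.* ℤ.- lucas i P Q)
    eq′ = begin
      _               ≡⟨ ι-⊗ c _ ⟨
      ι c ⊗ _         ≡⟨ cong (ι c ⊗_) (X↑n j) ⟨
      ι c ⊗ X ↑ j     ≈⟨ eq ⟩
      ι d ⊗ Y ↑ i     ≡⟨ cong (ι d ⊗_) (Y↑n i) ⟩
      ι d ⊗ _         ≡⟨ ι-⊗ d _ ⟩
      _               ∎

  module _ (p-prime : Prime p) (h : ℕ) (2h+1≡p : suc (2 ℕ.* h) ≡ p) where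
    open PrimeModulus p-prime

    -- The ring has zero divisors when D is a square modulo p, but scalars nonzero modulo p cancel
    -- in each coordinate separately.
    ι-cancel : ∀ {c} x y → c ≋̸0 → ι c ⊗ x ≈ ι c ⊗ y → x ≈ y
    ι-cancel {c} x y c≋̸0 eq = *-cancelˡ c≋̸0 (≈₁ eq′) & *-cancelˡ c≋̸0 (≈₂ eq′)
      where
      eq′ : (c ℤ.* proj₁ x , c ℤ.* proj₂ x) ≈ (c ℤ.* proj₁ y , c ℤ.* proj₂ y)
      eq′ = E.trans (≈-reflexive (sym (ι-⊗ c x))) (E.trans eq (≈-reflexive (ι-⊗ c y)))

    n·1≡n : ∀ n → n · ι (+ 1) ≡ ι (+ n)
    n·1≡n zero    = refl
    n·1≡n (suc n) = cong (ι (+ 1) ⊕_) (n·1≡n n)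

    char-p : p · ι (+ 1) ≈ ι (+ 0)
    char-p = E.trans (≈-reflexive (n·1≡n p)) (ι-cong p≋0)

    ι↑p≈ι : ∀ x → ι x ↑ p ≈ ι x
    ι↑p≈ι x = E.trans (≈-reflexive (ι-↑ x p)) (ι-cong (fermat x))

    δ↑p≈D^h⊗δ : δ ↑ p ≈ ι (discriminant ℤ.^ h) ⊗ δ
    δ↑p≈D^h⊗δ = begin
      δ ↑ p                            ≡⟨ cong (δ ↑_) 2h+1≡p ⟨
      δ ⊗ δ ↑ (2 ℕ.* h)                ≈⟨ ⊗-congˡ δ (↑-assocʳ δ 2 h) ⟨
      δ ⊗ (δ ↑ 2) ↑ h                  ≈⟨ ⊗-congˡ δ (↑-congˡ h (E.trans (⊗-congˡ δ (E.*-identityʳ δ)) δ⊗δ≈D)) ⟩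
      δ ⊗ ι discriminant ↑ h           ≡⟨ cong (δ ⊗_) (ι-↑ discriminant h) ⟩
      δ ⊗ ι (discriminant ℤ.^ h)       ≈⟨ ⊗-comm δ (ι (discriminant ℤ.^ h)) ⟩
      ι (discriminant ℤ.^ h) ⊗ δ       ∎

    -- Frobenius applied to 2X = P + δ.
    2X↑p : ι (+ 2) ⊗ X ↑ p ≈ ι P ⊕ ι (discriminant ℤ.^ h) ⊗ δ
    2X↑p = begin
      ι (+ 2) ⊗ X ↑ p         ≈⟨ ⊗-congʳ (X ↑ p) (E.sym (ι↑p≈ι (+ 2))) ⟩
      ι (+ 2) ↑ p ⊗ X ↑ p     ≈⟨ ↑-distrib-⊗ (ι (+ 2)) X p ⟨
      (ι (+ 2) ⊗ X) ↑ p       ≈⟨ ↑-congˡ p 2X≈P+δ ⟩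
      (ι P ⊕ δ) ↑ p           ≈⟨ Frobenius.frobenius E.commutativeSemiring p-prime char-p (ι P) δ ⟩
      ι P ↑ p ⊕ δ ↑ p         ≈⟨ ⊕-cong (ι↑p≈ι P) δ↑p≈D^h⊗δ ⟩
      ι P ⊕ ι (discriminant ℤ.^ h) ⊗ δ ∎
      where
      2X≈P+δ : ι (+ 2) ⊗ X ≈ ι P ⊕ δ
      2X≈P+δ = ≈-reflexive (trans (ι-⊗ (+ 2) X) (cong (_, + 2) (sym (ℤ.+-inverseʳ P))))

    2≋̸0 : + 2 ≋̸0
    2≋̸0 = 0<n<p⇒n≋̸0 (subst (2 <_) 2h+1≡p (2<2h+1 h refl))
      where
      2<2h+1 : ∀ k → k ≡ h → 2 < suc (2 ℕ.* k)
      2<2h+1 zero    refl = contradiction (subst Prime (sym 2h+1≡p) p-prime) λ ()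
      2<2h+1 (suc k) _    = s≤s (ℕ.*-monoʳ-≤ 2 (s≤s {0} {k} z≤n))

    X↑p≈X : discriminant ℤ.^ h ≋ + 1 → X ↑ p ≈ X
    X↑p≈X D^h≋1 = ι-cancel (X ↑ p) X 2≋̸0 (begin
      ι (+ 2) ⊗ X ↑ p                    ≈⟨ 2X↑p ⟩
      ι P ⊕ ι (discriminant ℤ.^ h) ⊗ δ   ≈⟨ ⊕-cong (E.refl {ι P}) (⊗-congʳ δ (ι-cong D^h≋1)) ⟩
      ι P ⊕ ι (+ 1) ⊗ δ                  ≡⟨ cong (ι P ⊕_) (ι-⊗ (+ 1) δ) ⟩
      (P ℤ.+ + 1 ℤ.* ℤ.- P , + 2)        ≡⟨ cong (_, + 2) (lemma P) ⟩
      (+ 0 , + 2)                        ≡⟨ ι-⊗ (+ 2) X ⟨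
      ι (+ 2) ⊗ X                        ∎)
      where
      lemma : ∀ P → P ℤ.+ + 1 ℤ.* ℤ.- P ≡ + 0
      lemma = ℤSolver.solve-∀

    X↑p≈Y : discriminant ℤ.^ h ≋ ℤ.- + 1 → X ↑ p ≈ Y
    X↑p≈Y D^h≋-1 = ι-cancel (X ↑ p) Y 2≋̸0 (begin
      ι (+ 2) ⊗ X ↑ p                    ≈⟨ 2X↑p ⟩
      ι P ⊕ ι (discriminant ℤ.^ h) ⊗ δ   ≈⟨ ⊕-cong (E.refl {ι P}) (⊗-congʳ δ (ι-cong D^h≋-1)) ⟩
      ι P ⊕ ι (ℤ.- + 1) ⊗ δ              ≡⟨ cong (ι P ⊕_) (ι-⊗ (ℤ.- + 1) δ) ⟩
      (P ℤ.+ ℤ.- + 1 ℤ.* ℤ.- P , ℤ.- + 2) ≡⟨ cong (_, ℤ.- + 2) (lemma P) ⟩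
      (+ 2 ℤ.* P , ℤ.- + 2)              ≡⟨ ι-⊗ (+ 2) Y ⟨
      ι (+ 2) ⊗ Y                        ∎)
      where
      lemma : ∀ P → P ℤ.+ ℤ.- + 1 ℤ.* ℤ.- P ≡ + 2 ℤ.* P
      lemma = ℤSolver.solve-∀

    lucas-reflect-residue : ∀ i j → Q ≋̸0 → discriminant ℤ.^ h ≋ + 1 → suc (i + j) ≡ p →
                            Q ℤ.^ i ℤ.* lucas j P Q ≋ ℤ.- lucas i P Q
    lucas-reflect-residue i j Q≋̸0 D^h≋1 i+j+1≡p =
      ≋-trans (second-coordinate (Q ℤ.^ i) (+ 1) i j (begin
        ι (Q ℤ.^ i) ⊗ X ↑ j     ≈⟨ Q^i⊗X↑j i j ⟩
        Y ↑ i ⊗ X ↑ (i + j)     ≈⟨ ⊗-congˡ (Y ↑ i) X↑[p-1]≈1 ⟩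
        Y ↑ i ⊗ ι (+ 1)         ≈⟨ ⊗-comm (Y ↑ i) (ι (+ 1)) ⟩
        ι (+ 1) ⊗ Y ↑ i         ∎))
      (≋-reflexive (cong ℤ.-_ (ℤ.*-identityˡ (lucas i P Q))))
      where
      -- To pass from α^p = α to α^(p-1) = 1, both sides are multiplied by β; then αβ = Q is a
      -- scalar and cancels.
      X↑[p-1]≈1 : X ↑ (i + j) ≈ ι (+ 1)
      X↑[p-1]≈1 = ι-cancel (X ↑ (i + j)) (ι (+ 1)) Q≋̸0 (begin
        ι Q ⊗ X ↑ (i + j)       ≈⟨ ⊗-congʳ (X ↑ (i + j)) (E.trans (E.sym X⊗Y≈Q) (⊗-comm X Y)) ⟩
        Y ⊗ X ⊗ X ↑ (i + j)     ≈⟨ ⊗-assoc Y X (X ↑ (i + j)) ⟩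
        Y ⊗ X ↑ suc (i + j)     ≡⟨ cong (λ n → Y ⊗ X ↑ n) i+j+1≡p ⟩
        Y ⊗ X ↑ p               ≈⟨ ⊗-congˡ Y (X↑p≈X D^h≋1) ⟩
        Y ⊗ X                   ≈⟨ ⊗-comm Y X ⟩
        X ⊗ Y                   ≈⟨ X⊗Y≈Q ⟩
        ι Q                     ≈⟨ E.*-identityʳ (ι Q) ⟨
        ι Q ⊗ ι (+ 1)           ∎)

    lucas-reflect-nonresidue : ∀ i j → discriminant ℤ.^ h ≋ ℤ.- + 1 → i + j ≡ suc p →
                               Q ℤ.^ i ℤ.* lucas j P Q ≋ ℤ.- (Q ℤ.* lucas i P Q)
    lucas-reflect-nonresidue i j D^h≋-1 i+j≡p+1 = second-coordinate (Q ℤ.^ i) Q i j (begin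
      ι (Q ℤ.^ i) ⊗ X ↑ j     ≈⟨ Q^i⊗X↑j i j ⟩
      Y ↑ i ⊗ X ↑ (i + j)     ≡⟨ cong (λ n → Y ↑ i ⊗ X ↑ n) i+j≡p+1 ⟩
      Y ↑ i ⊗ (X ⊗ X ↑ p)     ≈⟨ ⊗-congˡ (Y ↑ i) (E.trans (⊗-congˡ X (X↑p≈Y D^h≋-1)) X⊗Y≈Q) ⟩
      Y ↑ i ⊗ ι Q             ≈⟨ ⊗-comm (Y ↑ i) (ι Q) ⟩
      ι Q ⊗ Y ↑ i             ∎)

-- Ratios of consecutive binomial coefficients

-- Symmetry of the binomial coefficients turns this into `suc-k*nCk` for the complementary index;
-- writing n as i + j avoids truncated subtraction.
suc-j*nCi : ∀ {n} i j → i + j ≡ n → suc j ℕ.* (suc n C i) ≡ suc n ℕ.* (n C i)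
suc-j*nCi i j refl = begin
  suc j ℕ.* (suc (i + j) C i)              ≡⟨ cong (suc j ℕ.*_) (nCk≡nC[n∸k] {i} {suc (i + j)} (ℕ.m≤n⇒m≤1+n (ℕ.m≤m+n i j))) ⟩
  suc j ℕ.* (suc (i + j) C (suc (i + j) ∸ i)) ≡⟨ cong (λ r → suc j ℕ.* (suc (i + j) C r))
                                                (trans (cong (_∸ i) (sym (ℕ.+-suc i j))) (ℕ.m+n∸m≡n i (suc j))) ⟩
  suc j ℕ.* (suc (i + j) C suc j)          ≡⟨ suc-k*nCk (i + j) j ⟩
  suc (i + j) ℕ.* ((i + j) C j)            ≡⟨ cong (λ r → suc (i + j) ℕ.* ((i + j) C r)) (sym (ℕ.m+n∸m≡n i j)) ⟩
  suc (i + j) ℕ.* ((i + j) C (i + j ∸ i))  ≡⟨ cong (suc (i + j) ℕ.*_) (nCk≡nC[n∸k] (ℕ.m≤m+n i j)) ⟨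
  suc (i + j) ℕ.* ((i + j) C i)            ∎
  where open ≡-Reasoning

-- The path C(3k,k), C(3k+1,k), C(3k+2,k), C(3k+3,k+1) contributes the factors (3k + 1)/(2k + 1),
-- (3k + 2)/(2k + 2) and (3k + 3)/(k + 1) = 3.
3kCk-step : ∀ k → suc (2 ℕ.* k) ℕ.* (suc (suc (2 ℕ.* k)) ℕ.* ((3 ℕ.* suc k) C suc k)) ≡
                  3 ℕ.* (suc (3 ℕ.* k) ℕ.* (suc (suc (3 ℕ.* k)) ℕ.* ((3 ℕ.* k) C k)))
3kCk-step k = begin
  suc (2 ℕ.* k) ℕ.* (suc (suc (2 ℕ.* k)) ℕ.* ((3 ℕ.* suc k) C suc k))
    ≡⟨ cong (λ c → suc (2 ℕ.* k) ℕ.* (suc (suc (2 ℕ.* k)) ℕ.* c)) step₃ ⟩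
  suc (2 ℕ.* k) ℕ.* (suc (suc (2 ℕ.* k)) ℕ.* (3 ℕ.* c₂))
    ≡⟨ lemma₁ (suc (2 ℕ.* k)) (suc (suc (2 ℕ.* k))) c₂ ⟩
  3 ℕ.* (suc (2 ℕ.* k) ℕ.* (suc (suc (2 ℕ.* k)) ℕ.* c₂))
    ≡⟨ cong (λ c → 3 ℕ.* (suc (2 ℕ.* k) ℕ.* c)) (suc-j*nCi k (suc (2 ℕ.* k)) (ℕ.+-suc k (2 ℕ.* k))) ⟩
  3 ℕ.* (suc (2 ℕ.* k) ℕ.* (suc (suc (3 ℕ.* k)) ℕ.* c₁))
    ≡⟨ lemma₂ (suc (2 ℕ.* k)) (suc (suc (3 ℕ.* k))) c₁ ⟩
  3 ℕ.* (suc (suc (3 ℕ.* k)) ℕ.* (suc (2 ℕ.* k) ℕ.* c₁))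
    ≡⟨ cong (λ c → 3 ℕ.* (suc (suc (3 ℕ.* k)) ℕ.* c)) (suc-j*nCi k (2 ℕ.* k) refl) ⟩
  3 ℕ.* (suc (suc (3 ℕ.* k)) ℕ.* (suc (3 ℕ.* k) ℕ.* ((3 ℕ.* k) C k)))
    ≡⟨ lemma₂ (suc (suc (3 ℕ.* k))) (suc (3 ℕ.* k)) ((3 ℕ.* k) C k) ⟩
  3 ℕ.* (suc (3 ℕ.* k) ℕ.* (suc (suc (3 ℕ.* k)) ℕ.* ((3 ℕ.* k) C k))) ∎
  where
  open ≡-Reasoning
  c₁ = suc (3 ℕ.* k) C k
  c₂ = suc (suc (3 ℕ.* k)) C k
  lemma₁ : ∀ a b c → a ℕ.* (b ℕ.* (3 ℕ.* c)) ≡ 3 ℕ.* (a ℕ.* (b ℕ.* c))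
  lemma₁ = ℕSolver.solve-∀
  lemma₂ : ∀ a b c → 3 ℕ.* (a ℕ.* (b ℕ.* c)) ≡ 3 ℕ.* (b ℕ.* (a ℕ.* c))
  lemma₂ = ℕSolver.solve-∀
  lemma₃ : ∀ k c → (3 + 3 ℕ.* k) ℕ.* c ≡ (1 + k) ℕ.* (3 ℕ.* c)
  lemma₃ = ℕSolver.solve-∀
  step₃ : (3 ℕ.* suc k) C suc k ≡ 3 ℕ.* c₂
  step₃ = ℕ.*-cancelˡ-≡ _ _ (suc k) (begin
    suc k ℕ.* ((3 ℕ.* suc k) C suc k)              ≡⟨ cong (λ m → suc k ℕ.* (m C suc k)) (ℕ.*-suc 3 k) ⟩
    suc k ℕ.* (suc (suc (suc (3 ℕ.* k))) C suc k)  ≡⟨ suc-k*nCk (suc (suc (3 ℕ.* k))) k ⟩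
    (3 + 3 ℕ.* k) ℕ.* c₂                           ≡⟨ lemma₃ k c₂ ⟩
    suc k ℕ.* (3 ℕ.* c₂)                           ∎)

-- For m = 2k and l = n - k - 1 this is the step from C(n+k,2k) to C(n+k+1,2k+2).
C-shift₂ : ∀ m l → suc m ℕ.* (suc (suc m) ℕ.* (suc (suc (m + l)) C suc (suc m))) ≡
                   suc (suc (m + l)) ℕ.* (suc l ℕ.* (suc (m + l) C m))
C-shift₂ m l = begin
  suc m ℕ.* (suc (suc m) ℕ.* (suc (suc (m + l)) C suc (suc m)))
    ≡⟨ cong (suc m ℕ.*_) (suc-k*nCk (suc (m + l)) (suc m)) ⟩
  suc m ℕ.* (suc (suc (m + l)) ℕ.* (suc (m + l) C suc m))
    ≡⟨ lemma (suc m) (suc (suc (m + l))) (suc (m + l) C suc m) ⟩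
  suc (suc (m + l)) ℕ.* (suc m ℕ.* (suc (m + l) C suc m))
    ≡⟨ cong (suc (suc (m + l)) ℕ.*_) (suc-k*nCk (m + l) m) ⟩
  suc (suc (m + l)) ℕ.* (suc (m + l) ℕ.* ((m + l) C m))
    ≡⟨ cong (suc (suc (m + l)) ℕ.*_) (suc-j*nCi m l refl) ⟨
  suc (suc (m + l)) ℕ.* (suc l ℕ.* (suc (m + l) C m)) ∎
  where
  open ≡-Reasoning
  lemma : ∀ a b c → a ℕ.* (b ℕ.* c) ≡ b ℕ.* (a ℕ.* c)
  lemma = ℕSolver.solve-∀

pos-*₃ : ∀ a b c → + (a ℕ.* (b ℕ.* c)) ≡ + a ℤ.* (+ b ℤ.* + c)
pos-*₃ a b c = trans (ℤ.pos-* a (b ℕ.* c)) (cong (ℤ._*_ (+ a)) (ℤ.pos-* b c))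

-- Finite sums and the Morgan-Voyce recurrences

sum≤ : ℕ → (ℕ → ℤ) → ℤ
sum≤ zero    f = f 0
sum≤ (suc n) f = sum≤ n f ℤ.+ f (suc n)

sum≤-head : ∀ n f → sum≤ (suc n) f ≡ f 0 ℤ.+ sum≤ n (λ k → f (suc k))
sum≤-head zero    f = refl
sum≤-head (suc n) f = trans (cong (ℤ._+ f (suc (suc n))) (sum≤-head n f)) (ℤ.+-assoc (f 0) _ _)

sum≤-cong : ∀ n {f g} → (∀ k → f k ≡ g k) → sum≤ n f ≡ sum≤ n g
sum≤-cong zero    f≡g = f≡g 0
sum≤-cong (suc n) f≡g = cong₂ ℤ._+_ (sum≤-cong n f≡g) (f≡g (suc n))

sum≤-+ : ∀ n f g → sum≤ n (λ k → f k ℤ.+ g k) ≡ sum≤ n f ℤ.+ sum≤ n g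
sum≤-+ zero    f g = refl
sum≤-+ (suc n) f g = trans (cong (ℤ._+ (f (suc n) ℤ.+ g (suc n))) (sum≤-+ n f g))
                           (lemma (sum≤ n f) (sum≤ n g) (f (suc n)) (g (suc n)))
  where
  lemma : ∀ a b c d → (a ℤ.+ b) ℤ.+ (c ℤ.+ d) ≡ (a ℤ.+ c) ℤ.+ (b ℤ.+ d)
  lemma = ℤSolver.solve-∀

sum≤-*ˡ : ∀ n c f → sum≤ n (λ k → c ℤ.* f k) ≡ c ℤ.* sum≤ n f
sum≤-*ˡ zero    c f = refl
sum≤-*ˡ (suc n) c f = trans (cong (ℤ._+ c ℤ.* f (suc n)) (sum≤-*ˡ n c f))
                            (sym (ℤ.*-distribˡ-+ c (sum≤ n f) (f (suc n))))

2*suc : ∀ n → 2 ℕ.* suc n ≡ suc (suc (2 ℕ.* n))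
2*suc = ℕ.*-suc 2

module _ (y : ℤ) where

  -- Only the even family occurs in the theorem, but Pascal's rule expresses each family through the
  -- other, so the recurrences need both.
  evenTerm oddTerm : ℕ → ℕ → ℤ
  evenTerm n j = + ((n + j) C (2 ℕ.* j)) ℤ.* y ℤ.^ j
  oddTerm  n j = + (suc (n + j) C suc (2 ℕ.* j)) ℤ.* y ℤ.^ j

  -- The Morgan-Voyce polynomials, evaluated at y.
  evenSum oddSum : ℕ → ℤ
  evenSum n = sum≤ n (evenTerm n)
  oddSum  n = sum≤ n (oddTerm n)

  evenTerm-suc : ∀ n j → evenTerm (suc n) (suc j) ≡ y ℤ.* oddTerm n j ℤ.+ evenTerm n (suc j)
  evenTerm-suc n j = trans (cong (λ c → + c ℤ.* y ℤ.^ suc j) pascal)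
    (lemma y (+ (suc (n + j) C suc (2 ℕ.* j))) (+ ((n + suc j) C (2 ℕ.* suc j))) (y ℤ.^ j))
    where
    pascal : (suc n + suc j) C (2 ℕ.* suc j) ≡ (suc (n + j) C suc (2 ℕ.* j)) + ((n + suc j) C (2 ℕ.* suc j))
    pascal = trans (cong₂ _C_ (cong suc (ℕ.+-suc n j)) (2*suc j))
      (trans (sym (nCk+nC[k+1]≡[n+1]C[k+1] (suc (n + j)) (suc (2 ℕ.* j))))
        (cong ((suc (n + j) C suc (2 ℕ.* j)) ℕ.+_) (sym (cong₂ _C_ (ℕ.+-suc n j) (2*suc j)))))
    lemma : ∀ y a b z → (a ℤ.+ b) ℤ.* (y ℤ.* z) ≡ y ℤ.* (a ℤ.* z) ℤ.+ b ℤ.* (y ℤ.* z)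
    lemma = ℤSolver.solve-∀

  oddTerm-suc : ∀ n j → oddTerm (suc n) j ≡ evenTerm (suc n) j ℤ.+ oddTerm n j
  oddTerm-suc n j = trans
    (cong (λ c → + c ℤ.* y ℤ.^ j) (sym (nCk+nC[k+1]≡[n+1]C[k+1] (suc (n + j)) (2 ℕ.* j))))
    (ℤ.*-distribʳ-+ (y ℤ.^ j) (+ (suc (n + j) C (2 ℕ.* j))) (+ (suc (n + j) C suc (2 ℕ.* j))))

  -- The recurrences call for a term with j = n + 1, just beyond the end of the sum for n; it is
  -- zero since 2n + 2 exceeds 2n + 1. The same happens in `oddTerm-vanish`.
  evenTerm-vanish : ∀ n → evenTerm n (suc n) ≡ + 0
  evenTerm-vanish n = cong (λ c → + c ℤ.* y ℤ.^ suc n)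
    (k>n⇒nCk≡0 (s≤s (ℕ.≤-reflexive (cong (λ m → n + suc m) (sym (ℕ.+-identityʳ n))))))

  oddTerm-vanish : ∀ n → oddTerm n (suc n) ≡ + 0
  oddTerm-vanish n = cong (λ c → + c ℤ.* y ℤ.^ suc n)
    (k>n⇒nCk≡0 (s≤s (s≤s (ℕ.≤-reflexive (cong (λ m → n + suc m) (sym (ℕ.+-identityʳ n)))))))

  evenSum-suc : ∀ n → evenSum (suc n) ≡ y ℤ.* oddSum n ℤ.+ evenSum n
  evenSum-suc n = begin
    evenSum (suc n)
      ≡⟨ sum≤-head n (evenTerm (suc n)) ⟩
    evenTerm (suc n) 0 ℤ.+ sum≤ n (λ j → evenTerm (suc n) (suc j))
      -- The term j = 0 is 1 for every n, so the head can be handed over to the sum for n.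
      ≡⟨ cong (ℤ._+_ (+ 1)) (sum≤-cong n (evenTerm-suc n)) ⟩
    evenTerm n 0 ℤ.+ sum≤ n (λ j → y ℤ.* oddTerm n j ℤ.+ evenTerm n (suc j))
      ≡⟨ cong (ℤ._+_ (+ 1)) (sum≤-+ n (λ j → y ℤ.* oddTerm n j) (λ j → evenTerm n (suc j))) ⟩
    evenTerm n 0 ℤ.+ (sum≤ n (λ j → y ℤ.* oddTerm n j) ℤ.+ sum≤ n (λ j → evenTerm n (suc j)))
      ≡⟨ lemma (evenTerm n 0) (sum≤ n (λ j → y ℤ.* oddTerm n j)) (sum≤ n (λ j → evenTerm n (suc j))) ⟩
    sum≤ n (λ j → y ℤ.* oddTerm n j) ℤ.+ (evenTerm n 0 ℤ.+ sum≤ n (λ j → evenTerm n (suc j)))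
      ≡⟨ cong₂ ℤ._+_ (sum≤-*ˡ n y (oddTerm n)) (sym (sum≤-head n (evenTerm n))) ⟩
    y ℤ.* oddSum n ℤ.+ (evenSum n ℤ.+ evenTerm n (suc n))
      ≡⟨ cong (λ t → y ℤ.* oddSum n ℤ.+ (evenSum n ℤ.+ t)) (evenTerm-vanish n) ⟩
    y ℤ.* oddSum n ℤ.+ (evenSum n ℤ.+ + 0)
      ≡⟨ cong (ℤ._+_ (y ℤ.* oddSum n)) (ℤ.+-identityʳ (evenSum n)) ⟩
    y ℤ.* oddSum n ℤ.+ evenSum n ∎
    where
    open ≡-Reasoning
    lemma : ∀ a b c → a ℤ.+ (b ℤ.+ c) ≡ b ℤ.+ (a ℤ.+ c)
    lemma = ℤSolver.solve-∀

  oddSum-suc : ∀ n → oddSum (suc n) ≡ evenSum (suc n) ℤ.+ oddSum n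
  oddSum-suc n = begin
    oddSum (suc n)
      ≡⟨ sum≤-cong (suc n) (oddTerm-suc n) ⟩
    sum≤ (suc n) (λ j → evenTerm (suc n) j ℤ.+ oddTerm n j)
      ≡⟨ sum≤-+ (suc n) (evenTerm (suc n)) (oddTerm n) ⟩
    evenSum (suc n) ℤ.+ (oddSum n ℤ.+ oddTerm n (suc n))
      ≡⟨ cong (λ t → evenSum (suc n) ℤ.+ (oddSum n ℤ.+ t)) (oddTerm-vanish n) ⟩
    evenSum (suc n) ℤ.+ (oddSum n ℤ.+ + 0)
      ≡⟨ cong (ℤ._+_ (evenSum (suc n))) (ℤ.+-identityʳ (oddSum n)) ⟩
    evenSum (suc n) ℤ.+ oddSum n ∎
    where open ≡-Reasoning

-- The sum of C(3k,k) as a Lucas number of odd index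

module BinomialSums (p : ℕ) where
  open Congruence p
  open SetoidReasoning setoid

  sum≤-≋ : ∀ n {f g} → (∀ {k} → k ≤ n → f k ≋ g k) → sum≤ n f ≋ sum≤ n g
  sum≤-≋ zero    f≋g = f≋g z≤n
  sum≤-≋ (suc n) f≋g = +-cong (sum≤-≋ n (λ k≤n → f≋g (ℕ.m≤n⇒m≤1+n k≤n))) (f≋g ℕ.≤-refl)

  module _ {P Q y} (-Qy≋P² : ℤ.- Q ℤ.* y ≋ P ℤ.* P) where

    -- The hypothesis says y = -P²/Q without dividing. Two steps of the Lucas recurrence become the
    -- Morgan-Voyce recurrences when P² is replaced by -Qy; since each step uses both parities, the
    -- two statements are proved together.
    lucas-odd  : ∀ n → lucas (suc (2 ℕ.* n)) P Q ≋ (ℤ.- Q) ℤ.^ n ℤ.* evenSum y n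
    lucas-even : ∀ n → lucas (suc (suc (2 ℕ.* n))) P Q ≋ P ℤ.* ((ℤ.- Q) ℤ.^ n ℤ.* oddSum y n)

    lucas-odd zero    = ≋-refl
    lucas-odd (suc n) = begin
      lucas (suc (2 ℕ.* suc n)) P Q
        ≡⟨ cong (λ m → lucas (suc m) P Q) (2*suc n) ⟩
      P ℤ.* lucas (suc (suc (2 ℕ.* n))) P Q ℤ.- Q ℤ.* lucas (suc (2 ℕ.* n)) P Q
        ≈⟨ +-cong (*-congˡ P (lucas-even n)) (-‿cong (*-congˡ Q (lucas-odd n))) ⟩
      P ℤ.* (P ℤ.* (N ℤ.* oddSum y n)) ℤ.- Q ℤ.* (N ℤ.* evenSum y n)
        ≡⟨ lemma₁ P Q N (oddSum y n) (evenSum y n) ⟩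
      N ℤ.* (P ℤ.* P ℤ.* oddSum y n ℤ.+ ℤ.- Q ℤ.* evenSum y n)
        ≈⟨ *-congˡ N (+-congʳ (ℤ.- Q ℤ.* evenSum y n) (*-cong (≋-sym -Qy≋P²) (≋-refl {oddSum y n}))) ⟩
      N ℤ.* (ℤ.- Q ℤ.* y ℤ.* oddSum y n ℤ.+ ℤ.- Q ℤ.* evenSum y n)
        ≡⟨ lemma₂ (ℤ.- Q) y N (oddSum y n) (evenSum y n) ⟩
      ℤ.- Q ℤ.* N ℤ.* (y ℤ.* oddSum y n ℤ.+ evenSum y n)
        ≡⟨ cong (ℤ.- Q ℤ.* N ℤ.*_) (evenSum-suc y n) ⟨
      (ℤ.- Q) ℤ.^ suc n ℤ.* evenSum y (suc n) ∎
      where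
      N = (ℤ.- Q) ℤ.^ n
      lemma₁ : ∀ P Q N o e → P ℤ.* (P ℤ.* (N ℤ.* o)) ℤ.- Q ℤ.* (N ℤ.* e) ≡ N ℤ.* (P ℤ.* P ℤ.* o ℤ.+ ℤ.- Q ℤ.* e)
      lemma₁ = ℤSolver.solve-∀
      lemma₂ : ∀ R y N o e → N ℤ.* (R ℤ.* y ℤ.* o ℤ.+ R ℤ.* e) ≡ R ℤ.* N ℤ.* (y ℤ.* o ℤ.+ e)
      lemma₂ = ℤSolver.solve-∀

    lucas-even zero    = ≋-reflexive (lemma P Q)
      where
      lemma : ∀ P Q → P ℤ.* + 1 ℤ.- Q ℤ.* + 0 ≡ P ℤ.* + 1
      lemma = ℤSolver.solve-∀
    lucas-even (suc n) = begin
      lucas (suc (suc (2 ℕ.* suc n))) P Q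
        ≡⟨⟩
      P ℤ.* lucas (suc (2 ℕ.* suc n)) P Q ℤ.- Q ℤ.* lucas (2 ℕ.* suc n) P Q
        ≡⟨ cong (λ m → P ℤ.* lucas (suc (2 ℕ.* suc n)) P Q ℤ.- Q ℤ.* lucas m P Q) (2*suc n) ⟩
      P ℤ.* lucas (suc (2 ℕ.* suc n)) P Q ℤ.- Q ℤ.* lucas (suc (suc (2 ℕ.* n))) P Q
        ≈⟨ +-cong (*-congˡ P (lucas-odd (suc n))) (-‿cong (*-congˡ Q (lucas-even n))) ⟩
      P ℤ.* (ℤ.- Q ℤ.* N ℤ.* evenSum y (suc n)) ℤ.- Q ℤ.* (P ℤ.* (N ℤ.* oddSum y n))
        ≡⟨ lemma P Q N (evenSum y (suc n)) (oddSum y n) ⟩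
      P ℤ.* (ℤ.- Q ℤ.* N ℤ.* (evenSum y (suc n) ℤ.+ oddSum y n))
        ≡⟨ cong (λ t → P ℤ.* (ℤ.- Q ℤ.* N ℤ.* t)) (oddSum-suc y n) ⟨
      P ℤ.* ((ℤ.- Q) ℤ.^ suc n ℤ.* oddSum y (suc n)) ∎
      where
      N = (ℤ.- Q) ℤ.^ n
      lemma : ∀ P Q N e o → P ℤ.* (ℤ.- Q ℤ.* N ℤ.* e) ℤ.- Q ℤ.* (P ℤ.* (N ℤ.* o)) ≡ P ℤ.* (ℤ.- Q ℤ.* N ℤ.* (e ℤ.+ o))
      lemma = ℤSolver.solve-∀

  module _ (p-prime : Prime p) (n : ℕ) (2n<p : 2 ℕ.* n < p)
           ([3n+1][3n+2]≋0 : (+ 3 ℤ.* + n ℤ.+ + 1) ℤ.* (+ 3 ℤ.* + n ℤ.+ + 2) ≋ + 0) where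
    open PrimeModulus p-prime

    -27ℤ : ℤ
    -27ℤ = ℤ.- + 27

    -- Induction on k through the two ratios. Their common denominators 2k + 1 and 2k + 2 are at
    -- most 2n < p in the step to k + 1, so they may be cancelled.
    3kCk≋ : ∀ {k} → k ≤ n → + ((3 ℕ.* k) C k) ≋ + ((n + k) C (2 ℕ.* k)) ℤ.* -27ℤ ℤ.^ k
    3kCk≋ {zero}  _   = ≋-refl
    3kCk≋ {suc k} k<n with ℕ.m≤n⇒∃[o]m+o≡n k<n
    ... | l , 1+k+l≡n = *-cancelˡ a≋̸0 (*-cancelˡ b≋̸0 (begin
      b ℤ.* (a ℤ.* + ((3 ℕ.* suc k) C suc k))
        ≡⟨ swap b a (+ ((3 ℕ.* suc k) C suc k)) ⟩
      a ℤ.* (b ℤ.* + ((3 ℕ.* suc k) C suc k))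
        ≡⟨ trans (sym (pos-*₃ (suc (2 ℕ.* k)) (suc (suc (2 ℕ.* k))) ((3 ℕ.* suc k) C suc k)))
             (trans (cong +_ (3kCk-step k)) cast₁) ⟩
      + 3 ℤ.* ((+ 1 ℤ.+ + 3 ℤ.* K) ℤ.* ((+ 2 ℤ.+ + 3 ℤ.* K) ℤ.* + ((3 ℕ.* k) C k)))
        ≈⟨ *-congˡ (+ 3) (*-congˡ (+ 1 ℤ.+ + 3 ℤ.* K) (*-congˡ (+ 2 ℤ.+ + 3 ℤ.* K) (3kCk≋ (ℕ.<⇒≤ k<n)))) ⟩
      + 3 ℤ.* ((+ 1 ℤ.+ + 3 ℤ.* K) ℤ.* ((+ 2 ℤ.+ + 3 ℤ.* K) ℤ.* (e ℤ.* z)))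
        ≡⟨ key K L e z ⟩
      main ℤ.+ + 3 ℤ.* (e ℤ.* z) ℤ.* H (+ 1 ℤ.+ (K ℤ.+ L))
        ≡⟨ cong (λ m → main ℤ.+ + 3 ℤ.* (e ℤ.* z) ℤ.* H m) (cong +_ 1+k+l≡n) ⟩
      main ℤ.+ + 3 ℤ.* (e ℤ.* z) ℤ.* H (+ n)
        ≈⟨ +-congˡ main (*-congˡ (+ 3 ℤ.* (e ℤ.* z)) [3n+1][3n+2]≋0) ⟩
      main ℤ.+ + 3 ℤ.* (e ℤ.* z) ℤ.* + 0
        ≡⟨ drop main (+ 3 ℤ.* (e ℤ.* z)) ⟩
      -27ℤ ℤ.* ((+ 2 ℤ.+ (+ 2 ℤ.* K ℤ.+ L)) ℤ.* ((+ 1 ℤ.+ L) ℤ.* e)) ℤ.* z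
        ≡⟨ cong (λ t → -27ℤ ℤ.* t ℤ.* z)
             (trans cast₂ (pos-*₃ (suc (2 ℕ.* k)) (suc (suc (2 ℕ.* k))) ((n + suc k) C (2 ℕ.* suc k)))) ⟩
      -27ℤ ℤ.* (a ℤ.* (b ℤ.* e′)) ℤ.* z
        ≡⟨ regroup -27ℤ a b e′ z ⟩
      b ℤ.* (a ℤ.* (e′ ℤ.* -27ℤ ℤ.^ suc k)) ∎))
      where
      K L a b e e′ z main : ℤ
      K = + k
      L = + l
      a = + suc (2 ℕ.* k)
      b = + suc (suc (2 ℕ.* k))
      e = + ((n + k) C (2 ℕ.* k))
      e′ = + ((n + suc k) C (2 ℕ.* suc k))
      z = -27ℤ ℤ.^ k
      main = -27ℤ ℤ.* ((+ 2 ℤ.+ (+ 2 ℤ.* K ℤ.+ L)) ℤ.* ((+ 1 ℤ.+ L) ℤ.* e)) ℤ.* z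

      H : ℤ → ℤ
      H m = (+ 3 ℤ.* m ℤ.+ + 1) ℤ.* (+ 3 ℤ.* m ℤ.+ + 2)

      2k+2<p : suc (suc (2 ℕ.* k)) < p
      2k+2<p = ℕ.≤-<-trans (subst (_≤ 2 ℕ.* n) (2*suc k) (ℕ.*-monoʳ-≤ 2 k<n)) 2n<p

      a≋̸0 : a ≋̸0
      a≋̸0 = 0<n<p⇒n≋̸0 (ℕ.<-trans (ℕ.n<1+n _) 2k+2<p)
      b≋̸0 : b ≋̸0
      b≋̸0 = 0<n<p⇒n≋̸0 2k+2<p

      swap : ∀ a b c → a ℤ.* (b ℤ.* c) ≡ b ℤ.* (a ℤ.* c)
      swap = ℤSolver.solve-∀
      drop : ∀ m w → m ℤ.+ w ℤ.* + 0 ≡ m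
      drop = ℤSolver.solve-∀
      regroup : ∀ t a b e z → t ℤ.* (a ℤ.* (b ℤ.* e)) ℤ.* z ≡ b ℤ.* (a ℤ.* (e ℤ.* (t ℤ.* z)))
      regroup = ℤSolver.solve-∀
      -- With n = 1 + K + L one has n - k = 1 + L and n + k + 1 = 2 + 2K + L. The last summand
      -- carries (3n + 1)(3n + 2), which vanishes modulo p.
      key : ∀ K L e z →
        + 3 ℤ.* ((+ 1 ℤ.+ + 3 ℤ.* K) ℤ.* ((+ 2 ℤ.+ + 3 ℤ.* K) ℤ.* (e ℤ.* z))) ≡
        ℤ.- + 27 ℤ.* ((+ 2 ℤ.+ (+ 2 ℤ.* K ℤ.+ L)) ℤ.* ((+ 1 ℤ.+ L) ℤ.* e)) ℤ.* z ℤ.+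
        + 3 ℤ.* (e ℤ.* z) ℤ.* ((+ 3 ℤ.* (+ 1 ℤ.+ (K ℤ.+ L)) ℤ.+ + 1) ℤ.* (+ 3 ℤ.* (+ 1 ℤ.+ (K ℤ.+ L)) ℤ.+ + 2))
      key = ℤSolver.solve-∀

      cast₁ : + (3 ℕ.* (suc (3 ℕ.* k) ℕ.* (suc (suc (3 ℕ.* k)) ℕ.* ((3 ℕ.* k) C k)))) ≡
              + 3 ℤ.* ((+ 1 ℤ.+ + 3 ℤ.* K) ℤ.* ((+ 2 ℤ.+ + 3 ℤ.* K) ℤ.* + ((3 ℕ.* k) C k)))
      cast₁ = trans (ℤ.pos-* 3 (suc (3 ℕ.* k) ℕ.* (suc (suc (3 ℕ.* k)) ℕ.* ((3 ℕ.* k) C k)))) (cong (ℤ._*_ (+ 3))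
        (trans (pos-*₃ (suc (3 ℕ.* k)) (suc (suc (3 ℕ.* k))) ((3 ℕ.* k) C k))
          (cong (λ t → (+ 1 ℤ.+ t) ℤ.* ((+ 2 ℤ.+ t) ℤ.* + ((3 ℕ.* k) C k))) (ℤ.pos-* 3 k))))

      n+k≡ : n + k ≡ suc (2 ℕ.* k + l)
      n+k≡ = trans (cong (_+ k) (sym 1+k+l≡n)) (lemma k l)
        where
        lemma : ∀ k l → suc (k + l + k) ≡ suc (2 ℕ.* k + l)
        lemma = ℕSolver.solve-∀

      cast₂ : (+ 2 ℤ.+ (+ 2 ℤ.* K ℤ.+ L)) ℤ.* ((+ 1 ℤ.+ L) ℤ.* e) ≡
              + (suc (2 ℕ.* k) ℕ.* (suc (suc (2 ℕ.* k)) ℕ.* ((n + suc k) C (2 ℕ.* suc k))))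
      cast₂ = sym (≡.begin
        + (suc (2 ℕ.* k) ℕ.* (suc (suc (2 ℕ.* k)) ℕ.* ((n + suc k) C (2 ℕ.* suc k))))
          ≡.≡⟨ cong (λ c → + (suc (2 ℕ.* k) ℕ.* (suc (suc (2 ℕ.* k)) ℕ.* c)))
                 (cong₂ _C_ (trans (ℕ.+-suc n k) (cong suc n+k≡)) (2*suc k)) ⟩
        + (suc (2 ℕ.* k) ℕ.* (suc (suc (2 ℕ.* k)) ℕ.* (suc (suc (2 ℕ.* k + l)) C suc (suc (2 ℕ.* k)))))
          ≡.≡⟨ cong +_ (C-shift₂ (2 ℕ.* k) l) ⟩
        + (suc (suc (2 ℕ.* k + l)) ℕ.* (suc l ℕ.* (suc (2 ℕ.* k + l) C (2 ℕ.* k))))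
          ≡.≡⟨ pos-*₃ (suc (suc (2 ℕ.* k + l))) (suc l) (suc (2 ℕ.* k + l) C (2 ℕ.* k)) ⟩
        (+ 2 ℤ.+ (+ (2 ℕ.* k) ℤ.+ L)) ℤ.* ((+ 1 ℤ.+ L) ℤ.* + (suc (2 ℕ.* k + l) C (2 ℕ.* k)))
          ≡.≡⟨ cong₂ (λ t m → (+ 2 ℤ.+ (t ℤ.+ L)) ℤ.* ((+ 1 ℤ.+ L) ℤ.* + (m C (2 ℕ.* k)))) (ℤ.pos-* 2 k) (sym n+k≡) ⟩
        (+ 2 ℤ.+ (+ 2 ℤ.* K ℤ.+ L)) ℤ.* ((+ 1 ℤ.+ L) ℤ.* e) ≡.∎)
        where module ≡ = ≡-Reasoning

    -- For `c` the inverse of a modulo p, the argument -27b²c equals -P²/Q, as `lucas-odd` requires.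
    Σ3kCk≋evenSum : ∀ b c → sum≤ n (λ k → + ((3 ℕ.* k) C k) ℤ.* b ℤ.^ (2 ℕ.* k) ℤ.* c ℤ.^ k) ≋
                             evenSum (-27ℤ ℤ.* (b ℤ.* b ℤ.* c)) n
    Σ3kCk≋evenSum b c = sum≤-≋ n λ {k} k≤n → begin
      + ((3 ℕ.* k) C k) ℤ.* b ℤ.^ (2 ℕ.* k) ℤ.* c ℤ.^ k
        ≈⟨ *-cong (*-cong (3kCk≋ k≤n) (≋-refl {b ℤ.^ (2 ℕ.* k)})) (≋-refl {c ℤ.^ k}) ⟩
      + ((n + k) C (2 ℕ.* k)) ℤ.* -27ℤ ℤ.^ k ℤ.* b ℤ.^ (2 ℕ.* k) ℤ.* c ℤ.^ k
        ≡⟨ lemma (+ ((n + k) C (2 ℕ.* k))) (-27ℤ ℤ.^ k) (b ℤ.^ (2 ℕ.* k)) (c ℤ.^ k) ⟩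
      + ((n + k) C (2 ℕ.* k)) ℤ.* (-27ℤ ℤ.^ k ℤ.* b ℤ.^ (2 ℕ.* k) ℤ.* c ℤ.^ k)
        ≡⟨ cong (ℤ._*_ (+ ((n + k) C (2 ℕ.* k)))) (powers k) ⟩
      evenTerm (-27ℤ ℤ.* (b ℤ.* b ℤ.* c)) n k ∎
      where
      lemma : ∀ e x y z → e ℤ.* x ℤ.* y ℤ.* z ≡ e ℤ.* (x ℤ.* y ℤ.* z)
      lemma = ℤSolver.solve-∀
      lemma′ : ∀ t b c x y z → (t ℤ.* x) ℤ.* (b ℤ.* (b ℤ.* y)) ℤ.* (c ℤ.* z) ≡ t ℤ.* (b ℤ.* b ℤ.* c) ℤ.* (x ℤ.* y ℤ.* z)
      lemma′ = ℤSolver.solve-∀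
      powers : ∀ k → -27ℤ ℤ.^ k ℤ.* b ℤ.^ (2 ℕ.* k) ℤ.* c ℤ.^ k ≡ (-27ℤ ℤ.* (b ℤ.* b ℤ.* c)) ℤ.^ k
      powers zero    = refl
      powers (suc k) = trans (cong (λ m → -27ℤ ℤ.^ suc k ℤ.* b ℤ.^ m ℤ.* c ℤ.^ suc k) (2*suc k))
        (trans (lemma′ -27ℤ b c (-27ℤ ℤ.^ k) (b ℤ.^ (2 ℕ.* k)) (c ℤ.^ k))
               (cong (ℤ._*_ (-27ℤ ℤ.* (b ℤ.* b ℤ.* c))) (powers k)))

-- Integers inside the rationals

-- `ℤ→ℚ z` is normalised through a gcd and does not compute for a variable z; its homomorphism laws
-- are therefore checked on unnormalised fractions.
toℚᵘ-ℤ→ℚ : ∀ z → toℚᵘ (ℤ→ℚ z) ℚᵘ.≃ mkℚᵘ z 0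
toℚᵘ-ℤ→ℚ z = ℚ.toℚᵘ-fromℚᵘ (mkℚᵘ z 0)

ℤ→ℚ-+ : ∀ x y → ℤ→ℚ (x ℤ.+ y) ≡ ℤ→ℚ x ℚ.+ ℤ→ℚ y
ℤ→ℚ-+ x y = ℚ.toℚᵘ-injective (begin
  toℚᵘ (ℤ→ℚ (x ℤ.+ y))                ≈⟨ toℚᵘ-ℤ→ℚ (x ℤ.+ y) ⟩
  mkℚᵘ (x ℤ.+ y) 0                    ≈⟨ *≡* (lemma x y) ⟩
  mkℚᵘ x 0 ℚᵘ.+ mkℚᵘ y 0              ≈⟨ ℚᵘ.+-cong (toℚᵘ-ℤ→ℚ x) (toℚᵘ-ℤ→ℚ y) ⟨
  toℚᵘ (ℤ→ℚ x) ℚᵘ.+ toℚᵘ (ℤ→ℚ y)      ≈⟨ ℚ.toℚᵘ-homo-+ (ℤ→ℚ x) (ℤ→ℚ y) ⟨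
  toℚᵘ (ℤ→ℚ x ℚ.+ ℤ→ℚ y)              ∎)
  where
  open SetoidReasoning ℚᵘ.≃-setoid
  lemma : ∀ x y → (x ℤ.+ y) ℤ.* + 1 ≡ (x ℤ.* + 1 ℤ.+ y ℤ.* + 1) ℤ.* + 1
  lemma = ℤSolver.solve-∀

ℤ→ℚ-* : ∀ x y → ℤ→ℚ (x ℤ.* y) ≡ ℤ→ℚ x ℚ.* ℤ→ℚ y
ℤ→ℚ-* x y = ℚ.toℚᵘ-injective (begin
  toℚᵘ (ℤ→ℚ (x ℤ.* y))                ≈⟨ toℚᵘ-ℤ→ℚ (x ℤ.* y) ⟩
  mkℚᵘ x 0 ℚᵘ.* mkℚᵘ y 0              ≈⟨ ℚᵘ.*-cong (toℚᵘ-ℤ→ℚ x) (toℚᵘ-ℤ→ℚ y) ⟨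
  toℚᵘ (ℤ→ℚ x) ℚᵘ.* toℚᵘ (ℤ→ℚ y)      ≈⟨ ℚ.toℚᵘ-homo-* (ℤ→ℚ x) (ℤ→ℚ y) ⟨
  toℚᵘ (ℤ→ℚ x ℚ.* ℤ→ℚ y)              ∎)
  where
  open SetoidReasoning ℚᵘ.≃-setoid

ℤ→ℚ-neg : ∀ x → ℤ→ℚ (ℤ.- x) ≡ ℚ.- ℤ→ℚ x
ℤ→ℚ-neg x = ℚ.toℚᵘ-injective (begin
  toℚᵘ (ℤ→ℚ (ℤ.- x))                  ≈⟨ toℚᵘ-ℤ→ℚ (ℤ.- x) ⟩
  ℚᵘ.- mkℚᵘ x 0                       ≈⟨ ℚᵘ.-‿cong (toℚᵘ-ℤ→ℚ x) ⟨
  ℚᵘ.- toℚᵘ (ℤ→ℚ x)                   ≈⟨ ℚ.toℚᵘ-homo‿- (ℤ→ℚ x) ⟨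
  toℚᵘ (ℚ.- ℤ→ℚ x)                    ∎)
  where
  open SetoidReasoning ℚᵘ.≃-setoid

ℤ→ℚ-injective : ∀ {x y} → ℤ→ℚ x ≡ ℤ→ℚ y → x ≡ y
ℤ→ℚ-injective {x} {y} eq = trans (sym (ℤ.*-identityʳ x)) (trans x*1≡y*1 (ℤ.*-identityʳ y))
  where
  x*1≡y*1 : x ℤ.* + 1 ≡ y ℤ.* + 1
  x*1≡y*1 = ℚᵘ.drop-*≡* (ℚ.fromℚᵘ-injective {mkℚᵘ x 0} {mkℚᵘ y 0} eq)

x*↧x≡↥x : ∀ x → x ℚ.* ℤ→ℚ (↧ x) ≡ ℤ→ℚ (↥ x)
x*↧x≡↥x x@(mkℚ n d-1 _) = ℚ.toℚᵘ-injective (begin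
  toℚᵘ (x ℚ.* ℤ→ℚ (↧ x))              ≈⟨ ℚ.toℚᵘ-homo-* x (ℤ→ℚ (↧ x)) ⟩
  toℚᵘ x ℚᵘ.* toℚᵘ (ℤ→ℚ (↧ x))        ≈⟨ ℚᵘ.*-congˡ {toℚᵘ x} (toℚᵘ-ℤ→ℚ (↧ x)) ⟩
  mkℚᵘ n d-1 ℚᵘ.* mkℚᵘ (↧ x) 0        ≈⟨ *≡* (trans (ℤ.*-identityʳ (n ℤ.* ↧ x))
                                             (cong (λ d → n ℤ.* + d) (sym (ℕ.*-identityʳ (suc d-1))))) ⟩
  mkℚᵘ n 0                            ≈⟨ toℚᵘ-ℤ→ℚ n ⟨
  toℚᵘ (ℤ→ℚ (↥ x))                    ∎)
  where
  open SetoidReasoning ℚᵘ.≃-setoid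

fractions-agree : ∀ x d n e m → x ℚ.* ℤ→ℚ d ≡ ℤ→ℚ n → x ℚ.* ℤ→ℚ e ≡ ℤ→ℚ m → n ℤ.* e ≡ m ℤ.* d
fractions-agree x d n e m xd≡n xe≡m = ℤ→ℚ-injective (begin
  ℤ→ℚ (n ℤ.* e)               ≡⟨ ℤ→ℚ-* n e ⟩
  ℤ→ℚ n ℚ.* ℤ→ℚ e             ≡⟨ cong (ℚ._* ℤ→ℚ e) xd≡n ⟨
  x ℚ.* ℤ→ℚ d ℚ.* ℤ→ℚ e       ≡⟨ solve 3 (λ x d e → x :* d :* e := x :* e :* d) refl x (ℤ→ℚ d) (ℤ→ℚ e) ⟩
  x ℚ.* ℤ→ℚ e ℚ.* ℤ→ℚ d       ≡⟨ cong (ℚ._* ℤ→ℚ d) xe≡m ⟩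
  ℤ→ℚ m ℚ.* ℤ→ℚ d             ≡⟨ ℤ→ℚ-* m d ⟨
  ℤ→ℚ (m ℤ.* d)               ∎)
  where
  open ≡-Reasoning
  open +-*-Solver

-- Reduction of p-integral rationals modulo p

module Reduction (p : ℕ) (p-prime : Prime p) where
  open Congruence p
  open PrimeModulus p-prime
  open SetoidReasoning setoid

  infix 4 _↦_

  -- x is p-integral and its residue class modulo p is that of z.
  record _↦_ (x : ℚ) (z : ℤ) : Set where
    field
      den num    : ℤ
      den≋̸0      : den ≋̸0
      x*den≡num  : x ℚ.* ℤ→ℚ den ≡ ℤ→ℚ num
      num≋z*den  : num ≋ z ℤ.* den

  open _↦_

  ↦-≋ : ∀ {x z w} → x ↦ z → z ≋ w → x ↦ w
  ↦-≋ r z≋w = record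
    { den = den r ; num = num r ; den≋̸0 = den≋̸0 r ; x*den≡num = x*den≡num r
    ; num≋z*den = ≋-trans (num≋z*den r) (*-cong z≋w (≋-refl {den r})) }

  -- The two witnessing fractions of `x` may differ; cross-multiplication compares them and both
  -- denominators cancel.
  ↦-unique : ∀ {x z w} → x ↦ z → x ↦ w → z ≋ w
  ↦-unique {x} {z} {w} r s = *-cancelˡ (*-≋̸0 (den≋̸0 r) (den≋̸0 s)) (begin
    den r ℤ.* den s ℤ.* z     ≡⟨ lemma₁ (den r) (den s) z ⟩
    z ℤ.* den r ℤ.* den s     ≈⟨ *-cong (num≋z*den r) (≋-refl {den s}) ⟨
    num r ℤ.* den s           ≡⟨ fractions-agree x (den r) (num r) (den s) (num s) (x*den≡num r) (x*den≡num s) ⟩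
    num s ℤ.* den r           ≈⟨ *-cong (num≋z*den s) (≋-refl {den r}) ⟩
    w ℤ.* den s ℤ.* den r     ≡⟨ lemma₂ (den r) (den s) w ⟩
    den r ℤ.* den s ℤ.* w     ∎)
    where
    lemma₁ : ∀ a b z → a ℤ.* b ℤ.* z ≡ z ℤ.* a ℤ.* b
    lemma₁ = ℤSolver.solve-∀
    lemma₂ : ∀ a b w → w ℤ.* b ℤ.* a ≡ a ℤ.* b ℤ.* w
    lemma₂ = ℤSolver.solve-∀

  ↦-ℤ : ∀ z → ℤ→ℚ z ↦ z
  ↦-ℤ z = record
    { den = + 1 ; num = z ; den≋̸0 = 1≋̸0
    ; x*den≡num = trans (sym (ℤ→ℚ-* z (+ 1))) (cong ℤ→ℚ (ℤ.*-identityʳ z))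
    ; num≋z*den = ≋-reflexive (sym (ℤ.*-identityʳ z)) }

  ↦-+ : ∀ {x y z w} → x ↦ z → y ↦ w → x ℚ.+ y ↦ z ℤ.+ w
  ↦-+ {x} {y} {z} {w} r s = record
    { den = den r ℤ.* den s ; num = num r ℤ.* den s ℤ.+ num s ℤ.* den r ; den≋̸0 = *-≋̸0 (den≋̸0 r) (den≋̸0 s)
    ; x*den≡num = E.begin
        (x ℚ.+ y) ℚ.* ℤ→ℚ (den r ℤ.* den s)
          E.≡⟨ cong ((x ℚ.+ y) ℚ.*_) (ℤ→ℚ-* (den r) (den s)) ⟩
        (x ℚ.+ y) ℚ.* (ℤ→ℚ (den r) ℚ.* ℤ→ℚ (den s))
          E.≡⟨ solve 4 (λ x y d e → (x :+ y) :* (d :* e) := x :* d :* e :+ y :* e :* d) refl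
                x y (ℤ→ℚ (den r)) (ℤ→ℚ (den s)) ⟩
        x ℚ.* ℤ→ℚ (den r) ℚ.* ℤ→ℚ (den s) ℚ.+ y ℚ.* ℤ→ℚ (den s) ℚ.* ℤ→ℚ (den r)
          E.≡⟨ cong₂ (λ a b → a ℚ.* ℤ→ℚ (den s) ℚ.+ b ℚ.* ℤ→ℚ (den r)) (x*den≡num r) (x*den≡num s) ⟩
        ℤ→ℚ (num r) ℚ.* ℤ→ℚ (den s) ℚ.+ ℤ→ℚ (num s) ℚ.* ℤ→ℚ (den r)
          E.≡⟨ cong₂ ℚ._+_ (ℤ→ℚ-* (num r) (den s)) (ℤ→ℚ-* (num s) (den r)) ⟨
        ℤ→ℚ (num r ℤ.* den s) ℚ.+ ℤ→ℚ (num s ℤ.* den r)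
          E.≡⟨ ℤ→ℚ-+ (num r ℤ.* den s) (num s ℤ.* den r) ⟨
        ℤ→ℚ (num r ℤ.* den s ℤ.+ num s ℤ.* den r) E.∎
    ; num≋z*den = begin
        num r ℤ.* den s ℤ.+ num s ℤ.* den r
          ≈⟨ +-cong (*-cong (num≋z*den r) (≋-refl {den s})) (*-cong (num≋z*den s) (≋-refl {den r})) ⟩
        z ℤ.* den r ℤ.* den s ℤ.+ w ℤ.* den s ℤ.* den r
          ≡⟨ lemma z w (den r) (den s) ⟩
        (z ℤ.+ w) ℤ.* (den r ℤ.* den s) ∎ }
    where
    module E = ≡-Reasoning
    open +-*-Solver
    lemma : ∀ z w d e → z ℤ.* d ℤ.* e ℤ.+ w ℤ.* e ℤ.* d ≡ (z ℤ.+ w) ℤ.* (d ℤ.* e)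
    lemma = ℤSolver.solve-∀

  ↦-* : ∀ {x y z w} → x ↦ z → y ↦ w → x ℚ.* y ↦ z ℤ.* w
  ↦-* {x} {y} {z} {w} r s = record
    { den = den r ℤ.* den s ; num = num r ℤ.* num s ; den≋̸0 = *-≋̸0 (den≋̸0 r) (den≋̸0 s)
    ; x*den≡num = E.begin
        (x ℚ.* y) ℚ.* ℤ→ℚ (den r ℤ.* den s)
          E.≡⟨ cong ((x ℚ.* y) ℚ.*_) (ℤ→ℚ-* (den r) (den s)) ⟩
        (x ℚ.* y) ℚ.* (ℤ→ℚ (den r) ℚ.* ℤ→ℚ (den s))
          E.≡⟨ solve 4 (λ x y d e → (x :* y) :* (d :* e) := (x :* d) :* (y :* e)) refl x y (ℤ→ℚ (den r)) (ℤ→ℚ (den s)) ⟩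
        (x ℚ.* ℤ→ℚ (den r)) ℚ.* (y ℚ.* ℤ→ℚ (den s))
          E.≡⟨ cong₂ ℚ._*_ (x*den≡num r) (x*den≡num s) ⟩
        ℤ→ℚ (num r) ℚ.* ℤ→ℚ (num s)
          E.≡⟨ ℤ→ℚ-* (num r) (num s) ⟨
        ℤ→ℚ (num r ℤ.* num s) E.∎
    ; num≋z*den = begin
        num r ℤ.* num s                       ≈⟨ *-cong (num≋z*den r) (num≋z*den s) ⟩
        z ℤ.* den r ℤ.* (w ℤ.* den s)         ≡⟨ lemma z w (den r) (den s) ⟩
        (z ℤ.* w) ℤ.* (den r ℤ.* den s)       ∎ }
    where
    module E = ≡-Reasoning
    open +-*-Solver
    lemma : ∀ z w d e → z ℤ.* d ℤ.* (w ℤ.* e) ≡ (z ℤ.* w) ℤ.* (d ℤ.* e)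
    lemma = ℤSolver.solve-∀

  ↦-neg : ∀ {x z} → x ↦ z → ℚ.- x ↦ ℤ.- z
  ↦-neg {x} {z} r = record
    { den = den r ; num = ℤ.- num r ; den≋̸0 = den≋̸0 r
    ; x*den≡num = trans (sym (ℚ.neg-distribˡ-* x (ℤ→ℚ (den r)))) (trans (cong ℚ.-_ (x*den≡num r)) (sym (ℤ→ℚ-neg (num r))))
    ; num≋z*den = ≋-trans (-‿cong (num≋z*den r)) (≋-reflexive (ℤ.neg-distribˡ-* z (den r))) }

  -- Numerator and denominator change places; the old numerator is nonzero modulo p because `z` is a
  -- unit.
  ↦-1/ : ∀ {x z w} .{{_ : ℚ.NonZero x}} → x ↦ z → z ℤ.* w ≋ + 1 → ℚ.1/ x ↦ w
  ↦-1/ {x} {z} {w} r zw≋1 = record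
    { den = num r ; num = den r
    ; den≋̸0 = λ num≋0 → *-≋̸0 z≋̸0 (den≋̸0 r) (≋-trans (≋-sym (num≋z*den r)) num≋0)
    ; x*den≡num = E.begin
        ℚ.1/ x ℚ.* ℤ→ℚ (num r)             E.≡⟨ cong (ℚ.1/ x ℚ.*_) (x*den≡num r) ⟨
        ℚ.1/ x ℚ.* (x ℚ.* ℤ→ℚ (den r))     E.≡⟨ ℚ.*-assoc (ℚ.1/ x) x (ℤ→ℚ (den r)) ⟨
        ℚ.1/ x ℚ.* x ℚ.* ℤ→ℚ (den r)       E.≡⟨ cong (ℚ._* ℤ→ℚ (den r)) (ℚ.*-inverseˡ x) ⟩
        1ℚ ℚ.* ℤ→ℚ (den r)                 E.≡⟨ ℚ.*-identityˡ (ℤ→ℚ (den r)) ⟩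
        ℤ→ℚ (den r)                        E.∎
    ; num≋z*den = begin
        den r                      ≡⟨ ℤ.*-identityˡ (den r) ⟨
        + 1 ℤ.* den r              ≈⟨ *-cong zw≋1 (≋-refl {den r}) ⟨
        z ℤ.* w ℤ.* den r          ≡⟨ lemma z w (den r) ⟩
        w ℤ.* (z ℤ.* den r)        ≈⟨ *-congˡ w (num≋z*den r) ⟨
        w ℤ.* num r                ∎ }
    where
    module E = ≡-Reasoning
    lemma : ∀ z w d → z ℤ.* w ℤ.* d ≡ w ℤ.* (z ℤ.* d)
    lemma = ℤSolver.solve-∀
    z≋̸0 : z ≋̸0
    z≋̸0 z≋0 = 1≋̸0 (≋-trans (≋-sym zw≋1) (*-cong z≋0 (≋-refl {w})))

  PIntegral⇒↦ : ∀ x → PIntegral p x → ∃ λ z → x ↦ z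
  PIntegral⇒↦ x p∤↧x = ↥ x ℤ.* d⁻¹ , record
    { den = ↧ x ; num = ↥ x ; den≋̸0 = ↧x≋̸0
    ; x*den≡num = x*↧x≡↥x x
    ; num≋z*den = begin
        ↥ x                           ≡⟨ ℤ.*-identityʳ (↥ x) ⟨
        ↥ x ℤ.* + 1                   ≈⟨ *-congˡ (↥ x) (proj₂ (inverse ↧x≋̸0)) ⟨
        ↥ x ℤ.* (↧ x ℤ.* d⁻¹)         ≡⟨ lemma (↥ x) (↧ x) d⁻¹ ⟩
        ↥ x ℤ.* d⁻¹ ℤ.* ↧ x           ∎ }
    where
    ↧x≋̸0 : ↧ x ≋̸0
    ↧x≋̸0 ↧x≋0 = p∤↧x (≋0⇒∣ ↧x≋0)
    d⁻¹ = proj₁ (inverse ↧x≋̸0)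
    lemma : ∀ n d e → n ℤ.* (d ℤ.* e) ≡ n ℤ.* e ℤ.* d
    lemma = ℤSolver.solve-∀

  -- Passes from an arbitrary witnessing fraction to lowest terms: den · ↥x = num · ↧x, and `den`
  -- cancels.
  num*↧≋0⇒↥≋0 : ∀ {x z} (r : x ↦ z) → num r ℤ.* ↧ x ≋ + 0 → ↥ x ≋ + 0
  num*↧≋0⇒↥≋0 {x} r num*↧≋0 = x*y≋0⇒y≋0 (den≋̸0 r) (begin
    den r ℤ.* ↥ x     ≡⟨ ℤ.*-comm (den r) (↥ x) ⟩
    ↥ x ℤ.* den r     ≡⟨ fractions-agree x (den r) (num r) (↧ x) (↥ x) (x*den≡num r) (x*↧x≡↥x x) ⟨
    num r ℤ.* ↧ x     ≈⟨ num*↧≋0 ⟩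
    + 0               ∎)

  ↦0⇒↥≋0 : ∀ {x} → x ↦ + 0 → ↥ x ≋ + 0
  ↦0⇒↥≋0 {x} r = num*↧≋0⇒↥≋0 r (*-cong (num≋z*den r) (≋-refl {↧ x}))

  -- If p divided the reduced denominator, it would divide the reduced numerator as well, against
  -- coprimality.
  ↦⇒PIntegral : ∀ {x z} → x ↦ z → PIntegral p x
  ↦⇒PIntegral {x@(mkℚ _ _ coprime)} r p∣↧x =
    ¬prime[1] (subst Prime (Coprimality.recompute coprime (≋0⇒∣ ↥x≋0 , p∣↧x)) p-prime)
    where
    ↥x≋0 : ↥ x ≋ + 0
    ↥x≋0 = num*↧≋0⇒↥≋0 r (≋-trans (*-congˡ (num r) (∣⇒≋0 p∣↧x)) (≋-reflexive (ℤ.*-zeroʳ (num r))))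

  -- The quotient is x / p. Since `num` = q p, it is represented by q over the unchanged
  -- denominator, hence p-integral.
  ↦0⇒divisible : ∀ {x} → x ↦ + 0 → ∃ λ r → PIntegral p r × x ≡ ℕ→ℚ p ℚ.* r
  ↦0⇒divisible {x} r = quotient-by-p (∣-difference num≋0)
    where
    num≋0 : num r ≋ + 0
    num≋0 = num≋z*den r

    ℕ→ℚp≢0 : ℕ→ℚ p ≢ 0ℚ
    ℕ→ℚp≢0 eq = contradiction (subst Prime (ℤ.+-injective (ℤ→ℚ-injective {+ p} {+ 0} eq)) p-prime) λ ()

    instance
      p-nonZero : ℚ.NonZero (ℕ→ℚ p)
      p-nonZero = ℚ.≢-nonZero ℕ→ℚp≢0

    quotient-by-p : + p ℤ.∣ num r ℤ.- + 0 → ∃ λ s → PIntegral p s × x ≡ ℕ→ℚ p ℚ.* s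
    quotient-by-p (ℤ.divides q eq) = s , ↦⇒PIntegral s↦ , x≡ps
      where
      module E = ≡-Reasoning
      open +-*-Solver
      s = x ℚ.* ℚ.1/ ℕ→ℚ p
      den⁻¹ = proj₁ (inverse (den≋̸0 r))

      x≡ps : x ≡ ℕ→ℚ p ℚ.* s
      x≡ps = E.begin
        x                                   E.≡⟨ ℚ.*-identityʳ x ⟨
        x ℚ.* 1ℚ                            E.≡⟨ cong (x ℚ.*_) (ℚ.*-inverseʳ (ℕ→ℚ p)) ⟨
        x ℚ.* (ℕ→ℚ p ℚ.* ℚ.1/ ℕ→ℚ p)        E.≡⟨ solve 3 (λ x p i → x :* (p :* i) := p :* (x :* i)) refl
                                                   x (ℕ→ℚ p) (ℚ.1/ ℕ→ℚ p) ⟩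
        ℕ→ℚ p ℚ.* s                         E.∎

      num≡qp : num r ≡ q ℤ.* + p
      num≡qp = trans (sym (ℤ.+-identityʳ (num r))) eq

      lemma : ∀ q d e → (d ℤ.* e) ℤ.* q ≡ e ℤ.* q ℤ.* d
      lemma = ℤSolver.solve-∀

      s↦ : s ↦ den⁻¹ ℤ.* q
      s↦ = record
        { den = den r ; num = q ; den≋̸0 = den≋̸0 r
        ; x*den≡num = E.begin
            s ℚ.* ℤ→ℚ (den r)
              E.≡⟨ solve 3 (λ x i d → x :* i :* d := x :* d :* i) refl x (ℚ.1/ ℕ→ℚ p) (ℤ→ℚ (den r)) ⟩
            x ℚ.* ℤ→ℚ (den r) ℚ.* ℚ.1/ ℕ→ℚ p
              E.≡⟨ cong (ℚ._* ℚ.1/ ℕ→ℚ p) (trans (x*den≡num r) (trans (cong ℤ→ℚ num≡qp) (ℤ→ℚ-* q (+ p)))) ⟩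
            ℤ→ℚ q ℚ.* ℕ→ℚ p ℚ.* ℚ.1/ ℕ→ℚ p
              E.≡⟨ ℚ.*-assoc (ℤ→ℚ q) (ℕ→ℚ p) (ℚ.1/ ℕ→ℚ p) ⟩
            ℤ→ℚ q ℚ.* (ℕ→ℚ p ℚ.* ℚ.1/ ℕ→ℚ p)
              E.≡⟨ cong (ℤ→ℚ q ℚ.*_) (ℚ.*-inverseʳ (ℕ→ℚ p)) ⟩
            ℤ→ℚ q ℚ.* 1ℚ
              E.≡⟨ ℚ.*-identityʳ (ℤ→ℚ q) ⟩
            ℤ→ℚ q E.∎
        ; num≋z*den = begin
            q                             ≡⟨ ℤ.*-identityˡ q ⟨
            + 1 ℤ.* q                     ≈⟨ *-cong (proj₂ (inverse (den≋̸0 r))) (≋-refl {q}) ⟨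
            den r ℤ.* den⁻¹ ℤ.* q         ≡⟨ lemma q (den r) den⁻¹ ⟩
            den⁻¹ ℤ.* q ℤ.* den r         ∎ }

  -- Together with `≈⇒≋` this identifies congruence of p-integral rationals with `≋` on their
  -- residues, so hypotheses and conclusion can both be moved to the integers.
  ↦⇒≈ : ∀ {x y z w} → x ↦ z → y ↦ w → z ≋ w → x ≈ y [mod p ]
  ↦⇒≈ x↦z y↦w z≋w = ↦⇒PIntegral x↦z , ↦⇒PIntegral y↦w ,
    ↦0⇒divisible (↦-≋ (↦-+ x↦z (↦-neg y↦w)) (x≋y⇒x-y≋0 z≋w))

  ≈⇒≋ : ∀ {x y z w} → x ↦ z → y ↦ w → x ≈ y [mod p ] → z ≋ w
  ≈⇒≋ {x} {y} {z} {w} x↦z y↦w (_ , _ , r , r-int , x-y≡pr) = x-y≋0⇒x≋y (begin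
    z ℤ.- w      ≈⟨ ↦-unique (↦-+ x↦z (↦-neg y↦w)) (subst (_↦ (+ p ℤ.* t)) (sym x-y≡pr) (↦-* (↦-ℤ (+ p)) r↦t)) ⟩
    + p ℤ.* t    ≈⟨ *-cong p≋0 (≋-refl {t}) ⟩
    + 0          ∎)
    where
    t = proj₁ (PIntegral⇒↦ r r-int)
    r↦t = proj₂ (PIntegral⇒↦ r r-int)

  ↦-^ : ∀ {x z} → x ↦ z → ∀ n → x ^ℚ n ↦ z ℤ.^ n
  ↦-^ x↦z zero    = ↦-ℤ (+ 1)
  ↦-^ x↦z (suc n) = ↦-* x↦z (↦-^ x↦z n)

  ↦-sum : ∀ {f g} → (∀ k → f k ↦ g k) → ∀ n → sumTo n f ↦ sum≤ n g
  ↦-sum f↦g zero    = f↦g 0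
  ↦-sum f↦g (suc n) = ↦-+ (↦-sum f↦g n) (f↦g (suc n))

  ↦-U : ∀ {x y z w} → x ↦ z → y ↦ w → ∀ n → U n x y ↦ lucas n z w
  ↦-U x↦z y↦w zero          = ↦-ℤ (+ 0)
  ↦-U x↦z y↦w (suc zero)    = ↦-ℤ (+ 1)
  ↦-U x↦z y↦w (suc (suc n)) = ↦-+ (↦-* x↦z (↦-U x↦z y↦w (suc n))) (↦-neg (↦-* y↦w (↦-U x↦z y↦w n)))

-- Residues of p modulo 2 and 3

prime-%≢0 : ∀ {p} d → Prime p → suc (suc d) < p → p ℕ.% suc (suc d) ≢ 0
prime-%≢0 {p} d p-prime d<p p%d≡0 with prime⇒irreducible p-prime
  (divides (p ℕ./ suc (suc d)) (trans (ℕ.m≡m%n+[m/n]*n p (suc (suc d)))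
    (cong (_+ (p ℕ./ suc (suc d)) ℕ.* suc (suc d)) p%d≡0)))
... | inj₁ ()
... | inj₂ d≡p = ℕ.<⇒≢ d<p d≡p

prime-odd : ∀ {p} → Prime p → 2 < p → suc (2 ℕ.* (p ℕ./ 2)) ≡ p
prime-odd {p} p-prime 2<p = go (p ℕ.% 2) refl (ℕ.m%n<n p 2)
  where
  go : ∀ r → r ≡ p ℕ.% 2 → r < 2 → suc (2 ℕ.* (p ℕ./ 2)) ≡ p
  go 0 r≡ _ = contradiction (sym r≡) (prime-%≢0 0 p-prime 2<p)
  go 1 r≡ _ = sym (trans (ℕ.m≡m%n+[m/n]*n p 2) (cong₂ _+_ (sym r≡) (ℕ.*-comm (p ℕ./ 2) 2)))
  go (suc (suc _)) _ (s≤s (s≤s ()))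

prime-mod-3 : ∀ {p} → Prime p → 3 < p →
  (3 ℕ.* (p ℕ./ 3) + 1 ≡ p × idx p ≡ p ℕ./ 3) ⊎ (3 ℕ.* (p ℕ./ 3) + 2 ≡ p × idx p ≡ suc (p ℕ./ 3))
prime-mod-3 {p} p-prime 3<p = go (p ℕ.% 3) refl (ℕ.m%n<n p 3)
  where
  n = p ℕ./ 3

  p≡ : p ≡ p ℕ.% 3 + n ℕ.* 3
  p≡ = ℕ.m≡m%n+[m/n]*n p 3

  [x+1]-1 : ∀ x → x ℤ.+ + 1 ℤ.- + 1 ≡ x
  [x+1]-1 = ℤSolver.solve-∀

  go : ∀ r → p ℕ.% 3 ≡ r → r < 3 →
    (3 ℕ.* n + 1 ≡ p × idx p ≡ n) ⊎ (3 ℕ.* n + 2 ≡ p × idx p ≡ suc n)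
  go 0 eq _ = contradiction eq (prime-%≢0 1 p-prime 3<p)
  go 1 eq _ = inj₁ (p≡3n+1 , idx≡)
    where
    p≡3n+1 : 3 ℕ.* n + 1 ≡ p
    p≡3n+1 = sym (trans p≡ (trans (cong (_+ n ℕ.* 3) eq) (trans (ℕ.+-comm 1 (n ℕ.* 3)) (cong (_+ 1) (ℕ.*-comm n 3)))))
    idx≡ : idx p ≡ n
    idx≡ rewrite eq = trans (cong (λ m → ℤ.∣ m ∣ ℕ./ 3) p-1≡3n) (ℕ.m*n/n≡m n 3)
      where
      p-1≡3n : + p ℤ.- + 1 ≡ + (n ℕ.* 3)
      p-1≡3n = trans (cong (λ m → + m ℤ.- + 1) (sym p≡3n+1)) (trans ([x+1]-1 (+ (3 ℕ.* n))) (cong +_ (ℕ.*-comm 3 n)))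
  go 2 eq _ = inj₂ (p≡3n+2 , idx≡)
    where
    p≡3n+2 : 3 ℕ.* n + 2 ≡ p
    p≡3n+2 = sym (trans p≡ (trans (cong (_+ n ℕ.* 3) eq) (trans (ℕ.+-comm 2 (n ℕ.* 3)) (cong (_+ 2) (ℕ.*-comm n 3)))))
    idx≡ : idx p ≡ suc n
    -- Now `legendre3 p` is -1, and subtracting it computes to the natural number p + 1.
    idx≡ rewrite eq = trans (cong (ℕ._/ 3) p+1≡3n+3) (ℕ.m*n/n≡m (suc n) 3)
      where
      lemma : ∀ n → 3 ℕ.* n + 2 + 1 ≡ (1 + n) ℕ.* 3
      lemma = ℕSolver.solve-∀
      p+1≡3n+3 : p + 1 ≡ suc n ℕ.* 3
      p+1≡3n+3 = trans (cong (_+ 1) (sym p≡3n+2)) (lemma n)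
  go (suc (suc (suc _))) _ (s≤s (s≤s (s≤s ())))

-- The two congruences for integer residues A and B

module IntegerCase {p} (p-prime : Prime p) (3<p : 3 < p) (A B A⁻¹ : ℤ) where
  open Congruence p
  open PrimeModulus p-prime
  open BinomialSums p
  open SetoidReasoning setoid

  n : ℕ
  n = p ℕ./ 3

  P Q R y : ℤ
  P = + 9 ℤ.* B
  Q = + 3 ℤ.* A
  R = ℤ.- (+ 3 ℤ.* A)
  y = ℤ.- + 27 ℤ.* (B ℤ.* B ℤ.* A⁻¹)

  open QuadraticExtension p P Q using (discriminant; lucas-reflect-residue; lucas-reflect-nonresidue)

  D : ℤ
  D = + 81 ℤ.* B ℤ.* B ℤ.- + 12 ℤ.* A

  D≡discriminant : D ≡ discriminant
  D≡discriminant = lemma A B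
    where
    lemma : ∀ A B → + 81 ℤ.* B ℤ.* B ℤ.- + 12 ℤ.* A ≡ + 9 ℤ.* B ℤ.* (+ 9 ℤ.* B) ℤ.- + 4 ℤ.* (+ 3 ℤ.* A)
    lemma = ℤSolver.solve-∀

  S : ℤ
  S = sum≤ n (λ k → + ((3 ℕ.* k) C k) ℤ.* B ℤ.^ (2 ℕ.* k) ℤ.* A⁻¹ ℤ.^ k)

  2n<p : 2 ℕ.* n < p
  2n<p = ℕ.≤-<-trans (ℕ.*-monoˡ-≤ n (ℕ.n≤1+n 2)) (3n<p (prime-mod-3 p-prime 3<p))
    where
    3n<p : _ → 3 ℕ.* n < p
    3n<p (inj₁ (eq , _)) = subst (3 ℕ.* n <_) eq (ℕ.m<m+n (3 ℕ.* n) z<s)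
    3n<p (inj₂ (eq , _)) = subst (3 ℕ.* n <_) eq (ℕ.m<m+n (3 ℕ.* n) z<s)

  [3n+1][3n+2]≋0 : (+ 3 ℤ.* + n ℤ.+ + 1) ℤ.* (+ 3 ℤ.* + n ℤ.+ + 2) ≋ + 0
  [3n+1][3n+2]≋0 = go (prime-mod-3 p-prime 3<p)
    where
    cast : ∀ c → 3 ℕ.* n + c ≡ p → + 3 ℤ.* + n ℤ.+ + c ≋ + 0
    cast c eq = ≋-trans (≋-reflexive (trans (cong (ℤ._+ + c) (sym (ℤ.pos-* 3 n))) (cong +_ eq))) p≋0
    go : _ → (+ 3 ℤ.* + n ℤ.+ + 1) ℤ.* (+ 3 ℤ.* + n ℤ.+ + 2) ≋ + 0
    go (inj₁ (eq , _)) = *-cong (cast 1 eq) (≋-refl {+ 3 ℤ.* + n ℤ.+ + 2})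
    go (inj₂ (eq , _)) = ≋-trans (*-congˡ (+ 3 ℤ.* + n ℤ.+ + 1) (cast 2 eq)) (≋-reflexive (ℤ.*-zeroʳ (+ 3 ℤ.* + n ℤ.+ + 1)))

  h : ℕ
  h = p ℕ./ 2

  2h+1≡p : suc (2 ℕ.* h) ≡ p
  2h+1≡p = prime-odd p-prime (ℕ.<-trans (ℕ.n<1+n 2) 3<p)

  module _ (A*A⁻¹≋1 : A ℤ.* A⁻¹ ≋ + 1) where

    A≋̸0 : A ≋̸0
    A≋̸0 A≋0 = 1≋̸0 (≋-trans (≋-sym A*A⁻¹≋1) (*-cong A≋0 (≋-refl {A⁻¹})))

    Q≋̸0 : Q ≋̸0
    Q≋̸0 = *-≋̸0 (0<n<p⇒n≋̸0 3<p) A≋̸0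

    R^n≋̸0 : R ℤ.^ n ≋̸0
    R^n≋̸0 = ^-≋̸0 (λ R≋0 → Q≋̸0 (≋-trans (≋-reflexive (sym (ℤ.neg-involutive Q))) (-‿cong R≋0))) n

    Ry≋P² : R ℤ.* y ≋ P ℤ.* P
    Ry≋P² = begin
      R ℤ.* y                                   ≡⟨ lemma₁ A B A⁻¹ ⟩
      + 81 ℤ.* (B ℤ.* B) ℤ.* (A ℤ.* A⁻¹)        ≈⟨ *-congˡ (+ 81 ℤ.* (B ℤ.* B)) A*A⁻¹≋1 ⟩
      + 81 ℤ.* (B ℤ.* B) ℤ.* + 1                ≡⟨ lemma₂ B ⟩
      P ℤ.* P                                   ∎
      where
      lemma₁ : ∀ A B C → ℤ.- (+ 3 ℤ.* A) ℤ.* (ℤ.- + 27 ℤ.* (B ℤ.* B ℤ.* C)) ≡ + 81 ℤ.* (B ℤ.* B) ℤ.* (A ℤ.* C)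
      lemma₁ = ℤSolver.solve-∀
      lemma₂ : ∀ B → + 81 ℤ.* (B ℤ.* B) ℤ.* + 1 ≡ + 9 ℤ.* B ℤ.* (+ 9 ℤ.* B)
      lemma₂ = ℤSolver.solve-∀

    R^n*S≋U : R ℤ.^ n ℤ.* S ≋ lucas (suc (2 ℕ.* n)) P Q
    R^n*S≋U = ≋-trans (*-congˡ (R ℤ.^ n) (Σ3kCk≋evenSum p-prime n 2n<p [3n+1][3n+2]≋0 B A⁻¹))
                      (≋-sym (lucas-odd {P} {Q} {y} Ry≋P² n))

    -- Splits the even power of Q left by reflection into two copies of (-Q)^n; one cancels against
    -- the factor in `R^n*S≋U`, the other stays in the result.
    R^n*R^n≡Q^2n : R ℤ.^ n ℤ.* R ℤ.^ n ≡ Q ℤ.^ (2 ℕ.* n)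
    R^n*R^n≡Q^2n = E.begin
      R ℤ.^ n ℤ.* R ℤ.^ n     E.≡⟨ ℤ.^-distribˡ-+-* R n n ⟨
      R ℤ.^ (n + n)           E.≡⟨ cong (λ m → R ℤ.^ (n + m)) (ℕ.+-identityʳ n) ⟨
      R ℤ.^ (2 ℕ.* n)         E.≡⟨ ℤ.^-*-assoc R 2 n ⟨
      (R ℤ.^ 2) ℤ.^ n         E.≡⟨ cong (ℤ._^ n) (lemma Q) ⟩
      (Q ℤ.^ 2) ℤ.^ n         E.≡⟨ ℤ.^-*-assoc Q 2 n ⟩
      Q ℤ.^ (2 ℕ.* n)         E.∎
      where
      module E = ≡-Reasoning
      lemma : ∀ Q → ℤ.- Q ℤ.* (ℤ.- Q ℤ.* + 1) ≡ Q ℤ.* (Q ℤ.* + 1)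
      lemma = ℤSolver.solve-∀

    -- Reflection with i = 2n + 1 gives U_{2n+1} ≡ -Q^(2n+1) U_j, and -Q^(2n+1) = (-Q)^n (-Q)^(n+1).
    residue : D ≋̸0 → (∃ λ x → x ℤ.* x ≋ D) → S ≋ R ℤ.^ (n + 1) ℤ.* lucas (idx p ∸ 1) P Q
    residue D≋̸0 (x , x²≋D) = *-cancelˡ R^n≋̸0 (begin
      R ℤ.^ n ℤ.* S                               ≈⟨ R^n*S≋U ⟩
      lucas (suc (2 ℕ.* n)) P Q                   ≡⟨ ℤ.neg-involutive (lucas (suc (2 ℕ.* n)) P Q) ⟨
      ℤ.- ℤ.- lucas (suc (2 ℕ.* n)) P Q
        ≈⟨ -‿cong (lucas-reflect-residue p-prime h 2h+1≡p (suc (2 ℕ.* n)) (idx p ∸ 1) Q≋̸0 D^h≋1 index) ⟨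
      ℤ.- (Q ℤ.* Q ℤ.^ (2 ℕ.* n) ℤ.* V)           ≡⟨ cong (λ t → ℤ.- (Q ℤ.* t ℤ.* V)) R^n*R^n≡Q^2n ⟨
      ℤ.- (Q ℤ.* (R ℤ.^ n ℤ.* R ℤ.^ n) ℤ.* V)     ≡⟨ lemma Q (R ℤ.^ n) V ⟩
      R ℤ.^ n ℤ.* (R ℤ.* R ℤ.^ n ℤ.* V)           ≡⟨ cong (λ m → R ℤ.^ n ℤ.* (R ℤ.^ m ℤ.* V)) (ℕ.+-comm 1 n) ⟩
      R ℤ.^ n ℤ.* (R ℤ.^ (n + 1) ℤ.* V)           ∎)
      where
      V = lucas (idx p ∸ 1) P Q
      lemma : ∀ Q t V → ℤ.- (Q ℤ.* (t ℤ.* t) ℤ.* V) ≡ t ℤ.* (ℤ.- Q ℤ.* t ℤ.* V)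
      lemma = ℤSolver.solve-∀
      D^h≋1 : discriminant ℤ.^ h ≋ + 1
      D^h≋1 = subst (λ D → D ℤ.^ h ≋ + 1) D≡discriminant (euler-residue h 2h+1≡p {x} {D} D≋̸0 x²≋D)
      index : suc (suc (2 ℕ.* n) + (idx p ∸ 1)) ≡ p
      index = go (prime-mod-3 p-prime 3<p)
        where
        lemma₁ : ∀ m → suc (suc (2 ℕ.* suc m) + m) ≡ 3 ℕ.* suc m + 1
        lemma₁ = ℕSolver.solve-∀
        lemma₂ : ∀ m → suc (suc (2 ℕ.* m) + m) ≡ 3 ℕ.* m + 2
        lemma₂ = ℕSolver.solve-∀
        -- For p = 3n + 1 the index `idx p ∸ 1` is n ∸ 1, a true predecessor only when n is
        -- positive.
        n≥1 : 1 ≤ n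
        n≥1 = ℕ.m≥n⇒m/n>0 (ℕ.<⇒≤ 3<p)
        positive : ∀ m → 1 ≤ m → suc (suc (2 ℕ.* m) + (m ∸ 1)) ≡ 3 ℕ.* m + 1
        positive (suc m) _ = lemma₁ m
        go : _ → suc (suc (2 ℕ.* n) + (idx p ∸ 1)) ≡ p
        go (inj₁ (3n+1≡p , idx≡)) = trans (cong (λ m → suc (suc (2 ℕ.* n) + (m ∸ 1))) idx≡) (trans (positive n n≥1) 3n+1≡p)
        go (inj₂ (3n+2≡p , idx≡)) = trans (cong (λ m → suc (suc (2 ℕ.* n) + (m ∸ 1))) idx≡) (trans (lemma₂ n) 3n+2≡p)

    -- Here reflection has a factor Q on both sides. Cancelling it leaves Q^(2n) = (-Q)^n (-Q)^n,
    -- hence exponent n where `residue` has n + 1.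
    nonresidue : (∀ x → ¬ (x ℤ.* x ≋ D)) → S ≋ ℤ.- (R ℤ.^ n ℤ.* lucas (idx p + 1) P Q)
    nonresidue x²≋̸D = *-cancelˡ R^n≋̸0 (begin
      R ℤ.^ n ℤ.* S                               ≈⟨ R^n*S≋U ⟩
      W                                           ≈⟨ *-cancelˡ Q≋̸0 QW≋ ⟩
      ℤ.- (Q ℤ.^ (2 ℕ.* n) ℤ.* V)                 ≡⟨ cong (λ t → ℤ.- (t ℤ.* V)) R^n*R^n≡Q^2n ⟨
      ℤ.- (R ℤ.^ n ℤ.* R ℤ.^ n ℤ.* V)             ≡⟨ lemma (R ℤ.^ n) V ⟩
      R ℤ.^ n ℤ.* ℤ.- (R ℤ.^ n ℤ.* V)             ∎)
      where
      V = lucas (idx p + 1) P Q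
      W = lucas (suc (2 ℕ.* n)) P Q
      lemma : ∀ t V → ℤ.- (t ℤ.* t ℤ.* V) ≡ t ℤ.* ℤ.- (t ℤ.* V)
      lemma = ℤSolver.solve-∀
      lemma′ : ∀ Q t V → ℤ.- (Q ℤ.* t ℤ.* V) ≡ Q ℤ.* ℤ.- (t ℤ.* V)
      lemma′ = ℤSolver.solve-∀
      D^h≋-1 : discriminant ℤ.^ h ≋ ℤ.- + 1
      D^h≋-1 = subst (λ D → D ℤ.^ h ≋ ℤ.- + 1) D≡discriminant (euler-nonresidue h 2h+1≡p {D} x²≋̸D)
      index : suc (2 ℕ.* n) + (idx p + 1) ≡ suc p
      index = go (prime-mod-3 p-prime 3<p)
        where
        lemma₁ : ∀ m → suc (2 ℕ.* m) + (m + 1) ≡ suc (3 ℕ.* m + 1)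
        lemma₁ = ℕSolver.solve-∀
        lemma₂ : ∀ m → suc (2 ℕ.* m) + (suc m + 1) ≡ suc (3 ℕ.* m + 2)
        lemma₂ = ℕSolver.solve-∀
        go : _ → suc (2 ℕ.* n) + (idx p + 1) ≡ suc p
        go (inj₁ (3n+1≡p , idx≡)) = trans (cong (λ m → suc (2 ℕ.* n) + (m + 1)) idx≡) (trans (lemma₁ n) (cong suc 3n+1≡p))
        go (inj₂ (3n+2≡p , idx≡)) = trans (cong (λ m → suc (2 ℕ.* n) + (m + 1)) idx≡) (trans (lemma₂ n) (cong suc 3n+2≡p))
      QW≋ : Q ℤ.* W ≋ Q ℤ.* ℤ.- (Q ℤ.^ (2 ℕ.* n) ℤ.* V)
      QW≋ = begin
        Q ℤ.* W                                   ≡⟨ ℤ.neg-involutive (Q ℤ.* W) ⟨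
        ℤ.- ℤ.- (Q ℤ.* W)
          ≈⟨ -‿cong (lucas-reflect-nonresidue p-prime h 2h+1≡p (suc (2 ℕ.* n)) (idx p + 1) D^h≋-1 index) ⟨
        ℤ.- (Q ℤ.* Q ℤ.^ (2 ℕ.* n) ℤ.* V)         ≡⟨ lemma′ Q (Q ℤ.^ (2 ℕ.* n)) V ⟩
        Q ℤ.* ℤ.- (Q ℤ.^ (2 ℕ.* n) ℤ.* V)         ∎

-- Transfer to rationals with denominator prime to p

theorem3p3 : (p : ℕ) → Prime p → 3 < p → (a b : ℚ) → .{{_ : ℚ.NonZero a}} →
    PIntegral p a → PIntegral p b → ¬ (p ∣ ℤ.∣ ↥ (a ℚ.* b) ∣) →
    (LegendreOne p (ℕ→ℚ 81 ℚ.* b ℚ.* b ℚ.- ℕ→ℚ 12 ℚ.* a) →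
    sumTo (p ℕ./ 3) (λ k → ℕ→ℚ ((3 ℕ.* k) C k) ℚ.* (b ^ℚ (2 ℕ.* k)) ℚ.* ((ℚ.1/ a) ^ℚ k))
    ≈ ((ℚ.- (ℕ→ℚ 3 ℚ.* a)) ^ℚ (p ℕ./ 3 + 1)) ℚ.* U (idx p ∸ 1) (ℕ→ℚ 9 ℚ.* b) (ℕ→ℚ 3 ℚ.* a)
    [mod p ]) ×
    (LegendreMinusOne p (ℕ→ℚ 81 ℚ.* b ℚ.* b ℚ.- ℕ→ℚ 12 ℚ.* a) →
    sumTo (p ℕ./ 3) (λ k → ℕ→ℚ ((3 ℕ.* k) C k) ℚ.* (b ^ℚ (2 ℕ.* k)) ℚ.* ((ℚ.1/ a) ^ℚ k))
    ≈ ℚ.- (((ℚ.- (ℕ→ℚ 3 ℚ.* a)) ^ℚ (p ℕ./ 3)) ℚ.* U (idx p + 1) (ℕ→ℚ 9 ℚ.* b) (ℕ→ℚ 3 ℚ.* a))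
    [mod p ])
theorem3p3 p p-prime 3<p a b a-int b-int p∤ab = residue-case , nonresidue-case
  where
  open Congruence p
  open PrimeModulus p-prime
  open Reduction p p-prime

  A B A⁻¹ : ℤ
  A = proj₁ (PIntegral⇒↦ a a-int)
  B = proj₁ (PIntegral⇒↦ b b-int)

  a↦A : a ↦ A
  a↦A = proj₂ (PIntegral⇒↦ a a-int)
  b↦B : b ↦ B
  b↦B = proj₂ (PIntegral⇒↦ b b-int)

  A≋̸0 : A ≋̸0
  -- If A vanished modulo p, so would AB, and p would divide the reduced numerator of ab.
  A≋̸0 A≋0 = p∤ab (≋0⇒∣ (↦0⇒↥≋0 (↦-≋ (↦-* a↦A b↦B) (*-cong A≋0 (≋-refl {B})))))

  A⁻¹ = proj₁ (inverse A≋̸0)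

  open IntegerCase p-prime 3<p A B A⁻¹ using (D; S; residue; nonresidue)

  A*A⁻¹≋1 : A ℤ.* A⁻¹ ≋ + 1
  A*A⁻¹≋1 = proj₂ (inverse A≋̸0)

  P↦ : ℕ→ℚ 9 ℚ.* b ↦ + 9 ℤ.* B
  P↦ = ↦-* (↦-ℤ (+ 9)) b↦B

  Q↦ : ℕ→ℚ 3 ℚ.* a ↦ + 3 ℤ.* A
  Q↦ = ↦-* (↦-ℤ (+ 3)) a↦A

  Dℚ Sℚ Uℚ⁺ Uℚ⁻ : ℚ
  Dℚ = ℕ→ℚ 81 ℚ.* b ℚ.* b ℚ.- ℕ→ℚ 12 ℚ.* a
  Sℚ = sumTo (p ℕ./ 3) (λ k → ℕ→ℚ ((3 ℕ.* k) C k) ℚ.* (b ^ℚ (2 ℕ.* k)) ℚ.* ((ℚ.1/ a) ^ℚ k))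
  Uℚ⁺ = ((ℚ.- (ℕ→ℚ 3 ℚ.* a)) ^ℚ (p ℕ./ 3 + 1)) ℚ.* U (idx p ∸ 1) (ℕ→ℚ 9 ℚ.* b) (ℕ→ℚ 3 ℚ.* a)
  Uℚ⁻ = ℚ.- (((ℚ.- (ℕ→ℚ 3 ℚ.* a)) ^ℚ (p ℕ./ 3)) ℚ.* U (idx p + 1) (ℕ→ℚ 9 ℚ.* b) (ℕ→ℚ 3 ℚ.* a))

  D↦ : Dℚ ↦ D
  D↦ = ↦-+ (↦-* (↦-* (↦-ℤ (+ 81)) b↦B) b↦B) (↦-neg (↦-* (↦-ℤ (+ 12)) a↦A))

  S↦ : Sℚ ↦ S
  S↦ = ↦-sum (λ k → ↦-* (↦-* (↦-ℤ (+ ((3 ℕ.* k) C k))) (↦-^ b↦B (2 ℕ.* k))) (↦-^ (↦-1/ a↦A A*A⁻¹≋1) k)) (p ℕ./ 3)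

  square↦ : ∀ x → ℤ→ℚ x ℚ.* ℤ→ℚ x ↦ x ℤ.* x
  square↦ x = ↦-* (↦-ℤ x) (↦-ℤ x)

  residue-case : LegendreOne p Dℚ → Sℚ ≈ Uℚ⁺ [mod p ]
  residue-case (_ , D≉0 , x , x²≈D) =
    ↦⇒≈ S↦ (↦-* (↦-^ (↦-neg Q↦) (p ℕ./ 3 + 1)) (↦-U P↦ Q↦ (idx p ∸ 1)))
      (residue A*A⁻¹≋1 (λ D≋0 → D≉0 (↦⇒≈ D↦ (↦-ℤ (+ 0)) D≋0)) (x , ≈⇒≋ (square↦ x) D↦ x²≈D))

  nonresidue-case : LegendreMinusOne p Dℚ → Sℚ ≈ Uℚ⁻ [mod p ]
  nonresidue-case (_ , _ , x²≉D) =
    ↦⇒≈ S↦ (↦-neg (↦-* (↦-^ (↦-neg Q↦) (p ℕ./ 3)) (↦-U P↦ Q↦ (idx p + 1))))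
      (nonresidue A*A⁻¹≋1 (λ x x²≋D → x²≉D x (↦⇒≈ (square↦ x) D↦ x²≋D)))
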